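{- For every integer $k$, there is an integer $g(k)$ such that every graph of treewidth at least $g(k)$ has radius-$1$ blind cop-width larger than $k$.
   Context: All graphs are finite, simple and undirected. For a graph $G$ and a positive integer $r$, a blind strategy of radius $r$ is a sequence $C_1,\dots,C_m\subseteq V(G)$; it uses $\max_i |C_i|$ cops. The associated sets of possible robber positions are $A_1=V(G)\setminus C_1$ and, for $i\in[m-1]$, $A_{i+1}$ is the set of vertices $u\in V(G)\setminus C_{i+1}$ such that $G\setminus (C_i\cap C_{i+1})$ contains a path of length at most $r$ (length $0$ allowed) from some vertex of $A_i$ to $u$. The strategy is winning if $A_m=\emptyset$. The radius-$r$ blind cop-width $\mathrm{bcw}_r(G)$ is the minimum number of cops used by a winning strategy of radius $r$. -}

module Defs where

open import Data.Nat using (ℕ; zero; suc; _≤_; _∸_; _⊔_)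
open import Data.Bool using (Bool; true; false)
open import Data.Fin using (Fin)
open import Data.Fin.Subset using (Subset; _∈_; _∉_; ∁; _∩_; ∣_∣) renaming (⊥ to ∅)
open import Data.Vec using (lookup; tabulate)
open import Data.List using (List; []; _∷_; foldr; map; allFin)
open import Data.List.Relation.Unary.Unique.Propositional using (Unique)
open import Data.List.Relation.Unary.All using (All)
open import Data.Product using (Σ; _×_; ∃; ∃-syntax)
open import Data.Empty using (⊥)
open import Relation.Nullary using (¬_)
open import Relation.Binary.PropositionalEquality using (_≡_)

record Graph (n : ℕ) : Set where
  field
    adj     : Fin n → Fin n → Bool
    sym     : ∀ u v → adj u v ≡ adj v u
    irrefl  : ∀ v → adj v v ≡ false
open Graph public

data Walk {n : ℕ} (G : Graph n) (X : Subset n) : Fin n → Fin n → ℕ → Set where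
  here : ∀ {v} → v ∉ X → Walk G X v v 0
  step : ∀ {u v w ℓ} → u ∉ X → adj G u v ≡ true → Walk G X v w ℓ → Walk G X u w (suc ℓ)

vertices : ∀ {n} {G : Graph n} {X u w ℓ} → Walk G X u w ℓ → List (Fin n)
vertices (here {v} _) = v ∷ []
vertices (step {u} _ _ p) = u ∷ vertices p

Path : ∀ {n} → Graph n → Subset n → Fin n → Fin n → ℕ → Set
Path G X u w ℓ = Σ (Walk G X u w ℓ) (λ p → Unique (vertices p))

Connected : ∀ {n} → Graph n → Set
Connected {n} G = ∀ (u v : Fin n) → ∃[ ℓ ] Path G ∅ u v ℓ

Acyclic : ∀ {n} → Graph n → Set
Acyclic {n} G = ∀ (u v : Fin n) (ℓ : ℕ) → Path G ∅ u v ℓ → 2 ≤ ℓ → adj G v u ≡ true → ⊥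

record Tree : Set where
  field
    size      : ℕ
    nonempty  : 1 ≤ size
    graph     : Graph size
    connected : Connected graph
    acyclic   : Acyclic graph
open Tree public

record TreeDecomposition {n : ℕ} (G : Graph n) : Set where
  field
    tree  : Tree
    bag   : Fin (size tree) → Subset n
    covers-vertices : ∀ (v : Fin n) → ∃[ t ] v ∈ bag t
    covers-edges    : ∀ (u v : Fin n) → adj G u v ≡ true → ∃[ t ] (u ∈ bag t × v ∈ bag t)
    -- for each vertex v, the nodes whose bag contains v induce a connected subtree
    subtree : ∀ (v : Fin n) (s t : Fin (size tree)) → v ∈ bag s → v ∈ bag t →
              ∃[ ℓ ] Path (graph tree) (∁ (tabulate (λ x → lookup (bag x) v))) s t ℓ
open TreeDecomposition public

maximum : List ℕ → ℕ
maximum = foldr _⊔_ 0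

width : ∀ {n} {G : Graph n} → TreeDecomposition G → ℕ
width D = maximum (map (λ t → ∣ bag D t ∣) (allFin _)) ∸ 1

TreewidthAtLeast : ∀ {n} → Graph n → ℕ → Set
TreewidthAtLeast G g = ∀ (D : TreeDecomposition G) → g ≤ width D

-- A blind strategy C₁,…,C_m (m ≥ 1), given as C₁ and the list C₂,…,C_m.
record BlindStrategy (n : ℕ) : Set where
  constructor strategy
  field
    first : Subset n
    rest  : List (Subset n)
open BlindStrategy public

nextA : ∀ {n} → Graph n → ℕ → Subset n → (Fin n → Set) → Subset n → Fin n → Set
nextA G r Ci A Cj u =
  u ∉ Cj × ∃[ a ] (A a × ∃[ ℓ ] (ℓ ≤ r × Path G (Ci ∩ Cj) a u ℓ))

finalA-go : ∀ {n} → Graph n → ℕ → Subset n → (Fin n → Set) → List (Subset n) → Fin n → Set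
finalA-go G r Ci A [] = A
finalA-go G r Ci A (Cj ∷ Cs) = finalA-go G r Cj (nextA G r Ci A Cj) Cs

finalA : ∀ {n} → Graph n → ℕ → BlindStrategy n → Fin n → Set
finalA G r S = finalA-go G r (first S) (λ u → u ∉ first S) (rest S)

Winning : ∀ {n} → Graph n → ℕ → BlindStrategy n → Set
Winning G r S = ∀ u → ¬ finalA G r S u

copsUsed : ∀ {n} → BlindStrategy n → ℕ
copsUsed S = maximum (map ∣_∣ (first S ∷ rest S))

BcwGreaterThan : ∀ {n} → ℕ → Graph n → ℕ → Set
BcwGreaterThan r G k = ∀ (S : BlindStrategy _) → Winning G r S → copsUsed S ≤ k → ⊥

{-# OPTIONS --safe #-}
-- A winning radius-1 strategy with k cops, watched inside a vertex set U, loses at most k vertices of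
-- robber territory per step and gains the whole boundary; so every U contains sets of every prescribed
-- size (up to k) with at most k boundary vertices in U. Suppose the treewidth is nevertheless large:
-- then there is a large well-linked set W, and it orients the separations of low order of certain sets
-- U ("tangles of order t"), the whole vertex set among them.
--
-- Sweeping a tangle costs k in order and halves its size. Conversely the order can be raised at a
-- polynomial price. If a free set of U is linked to the starts of many disjoint walks much longer than
-- |U|, then attaching those walks to U gives a set without balanced sweep; hence in every linkage
-- between parts of W almost all walks are short. Taking such short linkages between the two sides of
-- each nontrivial character on W (|W| = 2 ^ h), Parseval shows that their union is a tangle of order
-- about the square root of |W|. Its size is |U| times a polynomial in |W|, so logarithmically many
-- sweeps, which the raised order pays for, yield a tangle of the original order smaller than U.
module Submission where

open import Defs
open import Data.Bool using (Bool; true; false; _∧_; _∨_; not; if_then_else_)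
import Data.Bool as Bool
open import Data.Bool.Properties using (¬-not; not-involutive; ∧-identityʳ)
open import Data.Empty using (⊥; ⊥-elim)
open import Data.Fin using (Fin; zero; suc; toℕ; fromℕ<)
open import Data.Fin.Properties using (any?)
import Data.Fin.Properties as Fin
open import Data.Fin.Subset using (Subset; ∣_∣) renaming (_∈_ to _∈ˢ_; _∉_ to _∉ˢ_; ⊥ to ∅)
open import Data.Fin.Subset.Properties using (x∈p∩q⁻; ∉⊥; x∈p⇒x∉∁p)
open import Data.List using (map; foldr; allFin) renaming ([] to []ˡ; _∷_ to _∷ˡ_)
import Data.List.Membership.DecPropositional as DecMembership
open import Data.List.Membership.Propositional using () renaming (_∈_ to _∈ˡ_)
open import Data.List.Relation.Unary.All using ([]; _∷_)
import Data.List.Relation.Unary.All as All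
open import Data.List.Relation.Unary.All.Properties using (¬Any⇒All¬)
open import Data.List.Relation.Unary.AllPairs using ([]; _∷_)
import Data.List.Relation.Unary.AllPairs as AllPairs
import Data.List.Relation.Unary.AllPairs.Properties as AllPairs
open import Data.List.Relation.Unary.Any using (here; there)
open import Data.List.Relation.Unary.Unique.Propositional using (Unique)
open import Data.Nat using (ℕ; zero; suc; _+_; _*_; _^_; _⊔_; _≤_; _<_; z≤n; s≤s; s≤s⁻¹; ⌊_/2⌋; ⌈_/2⌉; >-nonZero)
open import Data.Nat.Properties
open import Data.Nat.Tactic.RingSolver using (solve-∀)
open import Data.Product using (Σ; ∃-syntax; _×_; _,_; proj₁; proj₂)
open import Data.Sum using (_⊎_; inj₁; inj₂; [_,_]′)
open import Data.Unit using (⊤; tt)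
open import Data.Vec using (lookup; []; _∷_; tabulate)
open import Data.Vec.Properties using (lookup⇒[]=; []=⇒lookup; lookup∘tabulate)
open import Function using (_∘_; id)
open import Relation.Binary.PropositionalEquality
  using (_≡_; _≢_; refl; trans; cong; cong₂; subst; module ≡-Reasoning) renaming (sym to ≡-sym)
open import Relation.Nullary using (¬_; yes; no; ⌊_⌋; contradiction)
open import Relation.Nullary.Decidable using (¬¬-excluded-middle)
open import Algebra.Properties.Semiring.Sum +-*-semiring
  using (sum; sum-cong-≗; ∑-distrib-+; ∑-comm; *-distribʳ-sum)

-- Boolean sets and their cardinalities

-- The obstacle is that every halving costs `k` in order, so a tangle of fixed order survives only
-- boundedly many sweeps, while the graph may be arbitrarily large compared with `W`. Boosting helps
-- because the set it produces depends on `U` only through `# U`, which bounds the length of the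
-- walks. Its size is about `# U` times the square of `# W = 2 ^ h`, so `2 * h` halvings, plus a
-- number depending only on `k`, more than undo it. They cost order linear in `h`, far below the
-- square root of `2 ^ h`; nothing in this comparison depends on the graph, and the sizes of tangles
-- of one fixed order would descend forever. A single linkage shows only that a low-order separation
-- treats two halves of `W` nearly alike. Asking this for all characters at once forces one side to
-- contain almost all of `W`. Since the goal is a contradiction, matchings, linkages and free sets
-- are obtained only under double negation, with no search over subsets.

∧⁺ : ∀ {a b} → a ≡ true → b ≡ true → a ∧ b ≡ true
∧⁺ refl refl = refl

∧⁻ˡ : ∀ {a b} → a ∧ b ≡ true → a ≡ true
∧⁻ˡ {true} _ = refl

∧⁻ʳ : ∀ {a b} → a ∧ b ≡ true → b ≡ true
∧⁻ʳ {true} p = p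

∨⁺ˡ : ∀ {a b} → a ≡ true → a ∨ b ≡ true
∨⁺ˡ refl = refl

∨⁺ʳ : ∀ {a b} → b ≡ true → a ∨ b ≡ true
∨⁺ʳ {true}  _ = refl
∨⁺ʳ {false} p = p

∨⁻ : ∀ {a b} → a ∨ b ≡ true → a ≡ true ⊎ b ≡ true
∨⁻ {true}  _ = inj₁ refl
∨⁻ {false} p = inj₂ p

not⁺ : ∀ {a} → a ≡ false → not a ≡ true
not⁺ refl = refl

not⁻ : ∀ {a} → not a ≡ true → a ≡ false
not⁻ {false} _ = refl

true≢false : ∀ {a} {ℓ} {B : Set ℓ} → a ≡ true → a ≡ false → B
true≢false {true} _ ()

split : ∀ a → a ≡ true ⊎ a ≡ false
split true  = inj₁ refl
split false = inj₂ refl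

infix 4 _∈_ _∉_ _⊆_
infixr 7 _∩_ _∖_
infixr 6 _∪_

BSet : ℕ → Set
BSet n = Fin n → Bool

_∈_ _∉_ : ∀ {n} → Fin n → BSet n → Set
v ∈ A = A v ≡ true
v ∉ A = A v ≡ false

_⊆_ : ∀ {n} → BSet n → BSet n → Set
A ⊆ B = ∀ v → v ∈ A → v ∈ B

_∩_ _∪_ _∖_ : ∀ {n} → BSet n → BSet n → BSet n
(A ∩ B) v = A v ∧ B v
(A ∪ B) v = A v ∨ B v
(A ∖ B) v = A v ∧ not (B v)

full none : ∀ {n} → BSet n
full _ = true
none _ = false

opaque
  ∃ᵇ : ∀ {n} → BSet n → Bool
  ∃ᵇ A = ⌊ any? (λ v → A v Bool.≟ true) ⌋

  ∃ᵇ⁺ : ∀ {n} {A : BSet n} v → v ∈ A → ∃ᵇ A ≡ true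
  ∃ᵇ⁺ {A = A} v p with any? (λ v → A v Bool.≟ true)
  ... | yes _ = refl
  ... | no  q = contradiction (v , p) q

  ∃ᵇ⁻ : ∀ {n} {A : BSet n} → ∃ᵇ A ≡ true → ∃[ v ] v ∈ A
  ∃ᵇ⁻ {A = A} p with any? (λ v → A v Bool.≟ true)
  ... | yes q = q

opaque
  _==_ : ∀ {n} → Fin n → Fin n → Bool
  u == v = ⌊ u Fin.≟ v ⌋

  ==⁺ : ∀ {n} {u v : Fin n} → u ≡ v → (u == v) ≡ true
  ==⁺ {u = u} {v} p with u Fin.≟ v
  ... | yes _ = refl
  ... | no  q = contradiction p q

  ==⁻ : ∀ {n} {u v : Fin n} → (u == v) ≡ true → u ≡ v
  ==⁻ {u = u} {v} p with u Fin.≟ v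
  ... | yes q = q

==⁻ᶠ : ∀ {n} {u v : Fin n} → (u == v) ≡ false → u ≢ v
==⁻ᶠ p q = true≢false (==⁺ q) p

⟦_⟧ : Bool → ℕ
⟦ true ⟧  = 1
⟦ false ⟧ = 0

infix 8 #_

opaque
  #_ : ∀ {n} → BSet n → ℕ
  # A = sum (λ v → ⟦ A v ⟧)

  sum-mono-≤ : ∀ {n} {f g : Fin n → ℕ} → (∀ v → f v ≤ g v) → sum f ≤ sum g
  sum-mono-≤ {zero}  _ = z≤n
  sum-mono-≤ {suc n} p = +-mono-≤ (p zero) (sum-mono-≤ (p ∘ suc))

  ⟦⟧-mono : ∀ {a b} → (a ≡ true → b ≡ true) → ⟦ a ⟧ ≤ ⟦ b ⟧
  ⟦⟧-mono {false}         _ = z≤n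
  ⟦⟧-mono {true}  {true}  _ = ≤-refl
  ⟦⟧-mono {true}  {false} p = contradiction (p refl) λ ()

  #-mono : ∀ {n} {A B : BSet n} → A ⊆ B → # A ≤ # B
  #-mono p = sum-mono-≤ (λ v → ⟦⟧-mono (p v))

  #-cover : ∀ {n} {A B C : BSet n} → (∀ v → v ∈ A → v ∈ B ⊎ v ∈ C) → # A ≤ # B + # C
  #-cover {A = A} {B} {C} p =
    ≤-trans (sum-mono-≤ pointwise) (≤-reflexive (∑-distrib-+ (λ v → ⟦ B v ⟧) (λ v → ⟦ C v ⟧)))
    where
    pointwise : ∀ v → ⟦ A v ⟧ ≤ ⟦ B v ⟧ + ⟦ C v ⟧
    pointwise v with A v in a
    ... | false = z≤n
    ... | true with p v a
    ...   | inj₁ b rewrite b = s≤s z≤n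
    ...   | inj₂ c rewrite c = m≤n+m 1 _

  #-pack : ∀ {n} {A B C : BSet n} → B ⊆ A → C ⊆ A → (∀ v → v ∈ B → v ∉ C) → # B + # C ≤ # A
  #-pack {A = A} {B} {C} b⊆a c⊆a disjoint =
    ≤-trans (≤-reflexive (≡-sym (∑-distrib-+ (λ v → ⟦ B v ⟧) (λ v → ⟦ C v ⟧)))) (sum-mono-≤ pointwise)
    where
    pointwise : ∀ v → ⟦ B v ⟧ + ⟦ C v ⟧ ≤ ⟦ A v ⟧
    pointwise v with B v in b
    ... | true rewrite b⊆a v b | disjoint v b = ≤-refl
    ... | false with C v in c
    ...   | true rewrite c⊆a v c = ≤-refl
    ...   | false = z≤n

  #-split : ∀ {n} (A B : BSet n) → # A ≡ # (A ∩ B) + # (A ∖ B)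
  #-split A B = ≤-antisym (#-cover cover) (#-pack (λ _ → ∧⁻ˡ) (λ _ → ∧⁻ˡ) disjoint)
    where
    cover : ∀ v → v ∈ A → v ∈ A ∩ B ⊎ v ∈ A ∖ B
    cover v a with B v
    ... | true  = inj₁ (∧⁺ a refl)
    ... | false = inj₂ (∧⁺ a refl)
    disjoint : ∀ v → v ∈ A ∩ B → v ∉ A ∖ B
    disjoint v p rewrite ∧⁻ʳ {A v} p | ∧⁻ˡ {A v} p = refl

  #-full : ∀ n → # (full {n}) ≡ n
  #-full zero    = refl
  #-full (suc n) = cong suc (#-full n)

  #-none : ∀ n → # (none {n}) ≡ 0
  #-none zero    = refl
  #-none (suc n) = #-none n

  #-empty : ∀ {n} {A : BSet n} → (∀ v → v ∉ A) → # A ≡ 0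
  #-empty {n} p = trans (sum-cong-≗ (λ v → cong ⟦_⟧ (p v))) (#-none n)

  #-member : ∀ {n} {A : BSet n} v → v ∈ A → 1 ≤ # A
  #-member {A = A} zero    p rewrite p = s≤s z≤n
  #-member {A = A} (suc v) p = ≤-trans (#-member v p) (m≤n+m _ ⟦ A zero ⟧)

  #-inhabited : ∀ {n} {A : BSet n} → 1 ≤ # A → ∃[ v ] v ∈ A
  #-inhabited {A = A} p with split (∃ᵇ A)
  ... | inj₁ q = ∃ᵇ⁻ q
  ... | inj₂ q = contradiction (≤-trans p (≤-reflexive (#-empty λ v → ¬-not λ r → true≢false (∃ᵇ⁺ v r) q))) λ ()

  #-excess : ∀ {n} {A B : BSet n} → # B < # A → ∃[ v ] v ∈ A × v ∉ B
  #-excess {A = A} {B} p with #-inhabited {A = A ∖ B} (+-cancelˡ-≤ (# B) 1 _ (begin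
      # B + 1                      ≡⟨ +-comm (# B) 1 ⟩
      suc (# B)                    ≤⟨ p ⟩
      # A                          ≡⟨ #-split A B ⟩
      # (A ∩ B) + # (A ∖ B)        ≤⟨ +-monoˡ-≤ _ (#-mono (λ v → ∧⁻ʳ {A v})) ⟩
      # B + # (A ∖ B)              ∎))
    where open ≤-Reasoning
  ... | v , q = v , ∧⁻ˡ q , not⁻ (∧⁻ʳ {A v} q)

  #-remove : ∀ {n} {A : BSet n} v → v ∈ A → # A ≡ suc (# (λ u → A u ∧ not (u == v)))
  #-remove {A = A} v p = ≤-antisym
    (≤-trans (#-cover cover) (+-monoˡ-≤ _ (single v)))
    (≤-trans (+-monoˡ-≤ _ (#-member v (==⁺ refl)))
      (#-pack (λ u q → subst (_∈ A) (≡-sym (==⁻ q)) p) (λ _ → ∧⁻ˡ) disjoint))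
    where
    cover : ∀ u → u ∈ A → u ∈ (_== v) ⊎ u ∈ (λ u → A u ∧ not (u == v))
    cover u a with u == v
    ... | true  = inj₁ refl
    ... | false = inj₂ (∧⁺ a refl)
    disjoint : ∀ u → u ∈ (_== v) → u ∉ (λ u → A u ∧ not (u == v))
    disjoint u q rewrite q with A u
    ... | true  = refl
    ... | false = refl
    single : ∀ {n} (v : Fin n) → # (_== v) ≤ 1
    single {suc n} zero rewrite ==⁺ {u = zero {n}} refl = s≤s (≤-reflexive (#-empty {n} (λ u → ¬-not (λ q → Fin.0≢1+n (≡-sym (==⁻ {u = suc u} {zero} q))))))
    single {suc n} (suc v) rewrite ¬-not (λ q → Fin.0≢1+n (==⁻ {u = zero} {suc v} q)) =
      ≤-trans (#-mono {B = _== v} (λ u q → ==⁺ (Fin.suc-injective (==⁻ {u = suc u} q)))) (single v)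

  -- The map takes the membership proof as an argument, so that it can return a witness extracted
  -- from that proof, such as the vertex where a walk crosses a boundary.
  #-inj : ∀ {m n} {P : BSet m} {Q : BSet n} (g : ∀ x → x ∈ P → Fin n) →
          (∀ x p → g x p ∈ Q) → (∀ x y p q → g x p ≡ g y q → x ≡ y) → # P ≤ # Q
  #-inj {zero}  g _ _ = z≤n
  #-inj {suc m} {n} {P} {Q} g g∈ g-inj with P zero in eq
  ... | false = #-inj (g ∘ suc) (g∈ ∘ suc) (λ x y p q r → Fin.suc-injective (g-inj _ _ p q r))
  ... | true  = subst (suc (# (P ∘ suc)) ≤_) (≡-sym (#-remove y (g∈ zero eq)))
      (s≤s (#-inj (g ∘ suc)
        (λ x p → ∧⁺ (g∈ (suc x) p) (not⁺ (¬-not (λ q → Fin.0≢1+n (≡-sym (g-inj _ _ p eq (==⁻ q)))))))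
        (λ x y p q r → Fin.suc-injective (g-inj _ _ p q r))))
    where
    y : Fin n
    y = g zero eq

  #-unique : ∀ {n} {A : BSet n} → (∀ u v → u ∈ A → v ∈ A → u ≡ v) → # A ≤ ⟦ ∃ᵇ A ⟧
  #-unique {A = A} p with split (∃ᵇ A)
  ... | inj₁ q rewrite q = #-inj {Q = full {1}} (λ _ _ → zero) (λ _ _ → refl) (λ u v a b _ → p u v a b)
  ... | inj₂ q rewrite q = ≤-reflexive (#-empty (λ v → ¬-not (λ r → true≢false (∃ᵇ⁺ v r) q)))

opaque
  ⋃ : ∀ {m n} → BSet m → (Fin m → BSet n) → BSet n
  ⋃ P R v = ∃ᵇ (λ x → P x ∧ R x v)

  ⋃⁺ : ∀ {m n} {P : BSet m} {R : Fin m → BSet n} {v} x → x ∈ P → v ∈ R x → v ∈ ⋃ P R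
  ⋃⁺ x p r = ∃ᵇ⁺ x (∧⁺ p r)

  ⋃⁻ : ∀ {m n} {P : BSet m} {R : Fin m → BSet n} {v} → v ∈ ⋃ P R → ∃[ x ] x ∈ P × v ∈ R x
  ⋃⁻ {P = P} q with ∃ᵇ⁻ q
  ... | x , r = x , ∧⁻ˡ r , ∧⁻ʳ {P x} r

module _ {m n} (P : BSet m) (R : Fin m → BSet n) (L : ℕ) where

  opaque
    unfolding #_ ⋃

    private
      double-count : sum (λ v → # (λ x → P x ∧ R x v)) ≡ sum (λ x → ⟦ P x ⟧ * # (R x))
      double-count = trans (∑-comm (λ v x → ⟦ P x ∧ R x v ⟧)) (sum-cong-≗ row)
        where
        row : ∀ x → # (λ v → P x ∧ R x v) ≡ ⟦ P x ⟧ * # (R x)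
        row x with P x
        ... | true  = ≡-sym (+-identityʳ _)
        ... | false = #-none n

    #-⋃-≤ : (∀ x → x ∈ P → # (R x) ≤ L) → # (⋃ P R) ≤ # P * L
    #-⋃-≤ p = begin
      # (⋃ P R)                             ≤⟨ sum-mono-≤ union-bound ⟩
      sum (λ v → # (λ x → P x ∧ R x v))     ≡⟨ double-count ⟩
      sum (λ x → ⟦ P x ⟧ * # (R x))         ≤⟨ sum-mono-≤ row ⟩
      sum (λ x → ⟦ P x ⟧ * L)               ≡⟨ *-distribʳ-sum L (λ x → ⟦ P x ⟧) ⟨
      # P * L                               ∎
      where
      open ≤-Reasoning
      union-bound : ∀ v → ⟦ ⋃ P R v ⟧ ≤ # (λ x → P x ∧ R x v)
      union-bound v with split (⋃ P R v)
      ... | inj₁ q rewrite q = let x , r = ∃ᵇ⁻ q in #-member x r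
      ... | inj₂ q rewrite q = z≤n
      row : ∀ x → ⟦ P x ⟧ * # (R x) ≤ ⟦ P x ⟧ * L
      row x with P x in eq
      ... | true  = +-monoˡ-≤ 0 (p x eq)
      ... | false = z≤n

    #-⋃-≥ : (∀ x → x ∈ P → L ≤ # (R x)) →
            (∀ x y v → x ∈ P → y ∈ P → v ∈ R x → v ∈ R y → x ≡ y) → # P * L ≤ # (⋃ P R)
    #-⋃-≥ p disjoint = begin
      # P * L                               ≡⟨ *-distribʳ-sum L (λ x → ⟦ P x ⟧) ⟩
      sum (λ x → ⟦ P x ⟧ * L)               ≤⟨ sum-mono-≤ row ⟩
      sum (λ x → ⟦ P x ⟧ * # (R x))         ≡⟨ double-count ⟨
      sum (λ v → # (λ x → P x ∧ R x v))     ≤⟨ sum-mono-≤ (λ v → #-unique (λ x y q r →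
                                                 disjoint x y v (∧⁻ˡ q) (∧⁻ˡ r) (∧⁻ʳ {P x} q) (∧⁻ʳ {P y} r))) ⟩
      # (⋃ P R)                             ∎
      where
      open ≤-Reasoning
      row : ∀ x → ⟦ P x ⟧ * L ≤ ⟦ P x ⟧ * # (R x)
      row x with P x in eq
      ... | true  = +-monoˡ-≤ 0 (p x eq)
      ... | false = z≤n

opaque
  unfolding #_

  #-between : ∀ {n} (A C : BSet n) m → A ⊆ C → # A ≤ m → m ≤ # C → ∃[ B ] A ⊆ B × B ⊆ C × # B ≡ m
  #-between {zero}  A C m _ _ z≤n = A , (λ _ p → p) , (λ ()) , refl
  #-between {suc n} A C m sub lo hi with A zero in a | C zero in c
  ... | true  | false = true≢false (sub zero a) c
  #-between {suc n} A C (suc m) sub (s≤s lo) (s≤s hi) | true | true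
    with #-between (A ∘ suc) (C ∘ suc) m (sub ∘ suc) lo hi
  ... | B , A⊆B , B⊆C , eq = (λ { zero → true ; (suc v) → B v }) ,
        (λ { zero _ → refl ; (suc v) p → A⊆B v p }) , (λ { zero _ → c ; (suc v) p → B⊆C v p }) , cong suc eq
  #-between {suc n} A C m sub lo hi | false | false
    with #-between (A ∘ suc) (C ∘ suc) m (sub ∘ suc) lo hi
  ... | B , A⊆B , B⊆C , eq = (λ { zero → false ; (suc v) → B v }) ,
        (λ { zero p → true≢false p a ; (suc v) p → A⊆B v p }) , (λ { zero () ; (suc v) p → B⊆C v p }) , eq
  -- Here vertex zero is optional. It is taken only when `m` equals `# C`, and then `C` itself is
  -- the answer.
  #-between {suc n} A C m sub lo hi | false | true with m≤n⇒m<n∨m≡n hi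
  ... | inj₂ eq = C , sub , (λ _ p → p) , trans (cong (λ b → ⟦ b ⟧ + # (C ∘ suc)) c) (≡-sym eq)
  ... | inj₁ (s≤s hi′) with #-between (A ∘ suc) (C ∘ suc) m (sub ∘ suc) lo hi′
  ...   | B , A⊆B , B⊆C , eq = (λ { zero → false ; (suc v) → B v }) ,
        (λ { zero p → true≢false p a ; (suc v) p → A⊆B v p }) , (λ { zero () ; (suc v) p → B⊆C v p }) , eq

-- Hall's theorem and disjoint walks

Matching : ∀ {n} → (Fin n → BSet n) → BSet n → BSet n → Set
Matching {n} R L Q = Σ (Fin n → Fin n) λ σ → (∀ u → u ∈ L → σ u ∈ R u × σ u ∈ Q)
                                           × (∀ u v → u ∈ L → v ∈ L → σ u ≡ σ v → u ≡ v)

-- The classical induction on the size of `L`, bounded by `m`. A nonempty proper tight subset is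
-- matched on its own and the rest outside its neighbourhood; if there is none, every nonempty
-- proper subset has a neighbour to spare, and any edge at a chosen vertex may be fixed.
hall : ∀ {n} (R : Fin n → BSet n) m (L Q : BSet n) → # L ≤ m →
       (∀ T → T ⊆ L → # T ≤ # (⋃ T R ∩ Q)) → ¬ ¬ Matching R L Q
hall R m L Q bound cond k with #-inhabited {A = L} | # L ≤? 0
... | _ | yes p = k (id , (λ u q → contradiction (≤-trans (#-member u q) p) λ ())
                        , (λ u v q → contradiction (≤-trans (#-member u q) p) λ ()))
hall R zero    L Q bound cond k | _   | no p = p bound
hall {n} R (suc m) L Q bound cond k | get | no p with get (≰⇒> p)
... | u , u∈L = ¬¬-excluded-middle
      {A = ∃[ T ] T ⊆ L × 1 ≤ # T × # T < # L × # (⋃ T R ∩ Q) ≤ # T} λ where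
    (yes (T , T⊆L , T≥1 , T<L , tight)) → splitting T T⊆L T≥1 T<L tight
    (no loose) → extending loose
  where
  splitting : ∀ T → T ⊆ L → 1 ≤ # T → # T < # L → # (⋃ T R ∩ Q) ≤ # T → ⊥
  splitting T T⊆L T≥1 T<L tight =
    hall R m T Q (s≤s⁻¹ (≤-trans T<L bound)) (λ S S⊆T → cond S (λ v → T⊆L v ∘ S⊆T v)) λ first →
    hall R m (L ∖ T) (Q ∖ ⋃ T R) rest-bound rest-cond λ second → k (combine first second)
    where
    rest-bound : # (L ∖ T) ≤ m
    rest-bound = +-cancelˡ-≤ 1 _ _ (begin
      1 + # (L ∖ T)            ≤⟨ +-monoˡ-≤ _ T≥1 ⟩
      # T + # (L ∖ T)          ≤⟨ +-monoˡ-≤ _ (#-mono (λ v q → ∧⁺ (T⊆L v q) q)) ⟩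
      # (L ∩ T) + # (L ∖ T)    ≡⟨ #-split L T ⟨
      # L                      ≤⟨ bound ⟩
      suc m                    ∎)
      where open ≤-Reasoning
    -- Hall's condition for `S ∪ T` loses at most `# T` to the neighbourhood of the tight set `T`.
    rest-cond : ∀ S → S ⊆ L ∖ T → # S ≤ # (⋃ S R ∩ (Q ∖ ⋃ T R))
    rest-cond S sub = +-cancelʳ-≤ (# T) _ _ (begin
      # S + # T                                              ≤⟨ #-pack (λ v → ∨⁺ˡ) (λ v → ∨⁺ʳ {S v}) (λ v q → not⁻ (∧⁻ʳ {L v} (sub v q))) ⟩
      # (S ∪ T)                                              ≤⟨ cond (S ∪ T) ∪⊆L ⟩
      # (⋃ (S ∪ T) R ∩ Q)                                    ≤⟨ #-cover {B = ⋃ S R ∩ (Q ∖ ⋃ T R)} cover ⟩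
      # (⋃ S R ∩ (Q ∖ ⋃ T R)) + # (⋃ T R ∩ Q)                ≤⟨ +-monoʳ-≤ _ tight ⟩
      # (⋃ S R ∩ (Q ∖ ⋃ T R)) + # T                          ∎)
      where
      open ≤-Reasoning
      ∪⊆L : S ∪ T ⊆ L
      ∪⊆L v q with ∨⁻ {S v} q
      ... | inj₁ s = ∧⁻ˡ (sub v s)
      ... | inj₂ t = T⊆L v t
      cover : ∀ v → v ∈ ⋃ (S ∪ T) R ∩ Q → v ∈ ⋃ S R ∩ (Q ∖ ⋃ T R) ⊎ v ∈ ⋃ T R ∩ Q
      cover v q with split (⋃ T R v)
      ... | inj₁ t = inj₂ (∧⁺ t (∧⁻ʳ {⋃ (S ∪ T) R v} q))
      ... | inj₂ t with ⋃⁻ {P = S ∪ T} {R} {v} (∧⁻ˡ q)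
      ...   | x , st , r with ∨⁻ {S x} st
      ...     | inj₁ s = inj₁ (∧⁺ (⋃⁺ {P = S} {R} x s r) (∧⁺ (∧⁻ʳ {⋃ (S ∪ T) R v} q) (not⁺ t)))
      ...     | inj₂ t′ = true≢false (⋃⁺ {P = T} {R} x t′ r) t
    combine : Matching R T Q → Matching R (L ∖ T) (Q ∖ ⋃ T R) → Matching R L Q
    combine (σ , σ-ok , σ-inj) (τ , τ-ok , τ-inj) =
      (λ v → if T v then σ v else τ v) ,
      (λ v v∈L → ok v v∈L (T v) refl) ,
      (λ v w v∈L w∈L → inj v w v∈L w∈L (T v) (T w) refl refl)
      where
      clash : ∀ v w → v ∈ T → w ∈ L ∖ T → σ v ≡ τ w → ⊥
      clash v w v∈T w∈ eq = true≢false (⋃⁺ {P = T} {R} v v∈T (proj₁ (σ-ok v v∈T)))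
        (trans (cong (⋃ T R) eq) (not⁻ (∧⁻ʳ {Q (τ w)} (proj₂ (τ-ok w w∈)))))
      ok : ∀ v → v ∈ L → ∀ b → T v ≡ b →
           (if b then σ v else τ v) ∈ R v × (if b then σ v else τ v) ∈ Q
      ok v v∈L true  t = σ-ok v t
      ok v v∈L false t = let r , q = τ-ok v (∧⁺ v∈L (not⁺ t)) in r , ∧⁻ˡ q
      inj : ∀ v w → v ∈ L → w ∈ L → ∀ b c → T v ≡ b → T w ≡ c →
            (if b then σ v else τ v) ≡ (if c then σ w else τ w) → v ≡ w
      inj v w v∈L w∈L true  true  t t′ = σ-inj v w t t′
      inj v w v∈L w∈L true  false t t′ eq = ⊥-elim (clash v w t (∧⁺ w∈L (not⁺ t′)) eq)
      inj v w v∈L w∈L false true  t t′ eq = ⊥-elim (clash w v t′ (∧⁺ v∈L (not⁺ t)) (≡-sym eq))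
      inj v w v∈L w∈L false false t t′ = τ-inj v w (∧⁺ v∈L (not⁺ t)) (∧⁺ w∈L (not⁺ t′))

  extending : ¬ (∃[ T ] T ⊆ L × 1 ≤ # T × # T < # L × # (⋃ T R ∩ Q) ≤ # T) → ⊥
  extending loose with #-inhabited {A = ⋃ (_== u) R ∩ Q}
    (≤-trans (#-member u (==⁺ refl)) (cond (_== u) (λ v q → subst (_∈ L) (≡-sym (==⁻ q)) u∈L)))
  ... | y , y∈ = hall R m L′ Q′ (s≤s⁻¹ (≤-trans (≤-reflexive (≡-sym (#-remove {A = L} u u∈L))) bound)) cond′ (k ∘ combine)
    where
    L′ = λ v → L v ∧ not (v == u)
    Q′ = λ v → Q v ∧ not (v == y)
    y∈R : y ∈ R u
    y∈R with ⋃⁻ {P = _== u} {R} {y} (∧⁻ˡ y∈)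
    ... | x , p , r = subst (λ x → y ∈ R x) (==⁻ p) r
    -- Deleting `y` costs a neighbourhood at most one vertex, which `loose` supplies.
    cond′ : ∀ S → S ⊆ L′ → # S ≤ # (⋃ S R ∩ Q′)
    cond′ S sub with 1 ≤? # S
    ... | no q  = ≤-trans (s≤s⁻¹ (≰⇒> q)) z≤n
    ... | yes q = +-cancelˡ-≤ 1 _ _ (begin
        1 + # S                       ≤⟨ ≰⇒> (λ tight → loose (S , (λ v → ∧⁻ˡ ∘ sub v) , q , smaller , tight)) ⟩
        # (⋃ S R ∩ Q)                 ≤⟨ #-cover cover ⟩
        # (_== y) + # (⋃ S R ∩ Q′)    ≤⟨ +-monoˡ-≤ _ (#-unique (λ u v a b → trans (==⁻ a) (≡-sym (==⁻ b)))) ⟩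
        ⟦ _ ⟧ + # (⋃ S R ∩ Q′)        ≤⟨ +-monoˡ-≤ _ (⟦⟧-mono {b = true} (λ _ → refl)) ⟩
        1 + # (⋃ S R ∩ Q′)            ∎)
      where
      open ≤-Reasoning
      smaller : # S < # L
      smaller = ≤-trans (s≤s (#-mono sub)) (≤-reflexive (≡-sym (#-remove {A = L} u u∈L)))
      cover : ∀ v → v ∈ ⋃ S R ∩ Q → v ∈ (_== y) ⊎ v ∈ ⋃ S R ∩ Q′
      cover v r with v == y
      ... | true  = inj₁ refl
      ... | false = inj₂ (∧⁺ (∧⁻ˡ {b = Q v} r) (∧⁺ (∧⁻ʳ {⋃ S R v} r) refl))
    combine : Matching R L′ Q′ → Matching R L Q
    combine (σ , σ-ok , σ-inj) =
      (λ v → if v == u then y else σ v) ,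
      (λ v v∈L → ok v v∈L (v == u) refl) ,
      (λ v w v∈L w∈L → inj v w v∈L w∈L (v == u) (w == u) refl refl)
      where
      ok : ∀ v → v ∈ L → ∀ b → (v == u) ≡ b →
           (if b then y else σ v) ∈ R v × (if b then y else σ v) ∈ Q
      ok v v∈L true  t = subst (λ x → y ∈ R x) (≡-sym (==⁻ t)) y∈R , ∧⁻ʳ {⋃ (_== u) R y} y∈
      ok v v∈L false t = let r , q = σ-ok v (∧⁺ v∈L (not⁺ t)) in r , ∧⁻ˡ q
      avoids-y : ∀ v → v ∈ L → (v == u) ≡ false → σ v ≢ y
      avoids-y v v∈L t = ==⁻ᶠ (not⁻ (∧⁻ʳ {Q (σ v)} (proj₂ (σ-ok v (∧⁺ v∈L (not⁺ t))))))
      inj : ∀ v w → v ∈ L → w ∈ L → ∀ b c → (v == u) ≡ b → (w == u) ≡ c →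
            (if b then y else σ v) ≡ (if c then y else σ w) → v ≡ w
      inj v w v∈L w∈L true  true  t t′ eq = trans (==⁻ t) (≡-sym (==⁻ t′))
      inj v w v∈L w∈L true  false t t′ eq = contradiction (≡-sym eq) (avoids-y w w∈L t′)
      inj v w v∈L w∈L false true  t t′ eq = contradiction eq (avoids-y v v∈L t)
      inj v w v∈L w∈L false false t t′ eq = σ-inj v w (∧⁺ v∈L (not⁺ t)) (∧⁺ w∈L (not⁺ t′)) eq

module _ {n} (G : Graph n) where

  -- A linkage from X to Y is encoded by a single injection: it moves every vertex outside Y
  -- along an edge (or not at all) and avoids X, so its orbits started in X run disjointly into Y.
  record Linkage (X Y : BSet n) : Set where
    field
      next      : Fin n → Fin n
      moves     : ∀ u → u ∉ Y → next u ≡ u ⊎ adj G u (next u) ≡ true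
      avoids    : ∀ u → u ∉ Y → next u ∉ X
      injective : ∀ u v → u ∉ Y → v ∉ Y → next u ≡ next v → u ≡ v

  -- Encodes the separation with sides `A ∪ C` and the complement of `A`; their intersection lies in
  -- `C`, which may also meet `A`.
  Closes : BSet n → BSet n → Set
  Closes A C = ∀ u v → u ∈ A → adj G u v ≡ true → v ∉ A → v ∈ C

  -- A linkage is a matching between the vertices outside Y and those outside X in the closed
  -- neighbourhood relation; a set T violating Hall's condition gives the separator (N T ∪ X) ∖ T.
  menger : ∀ X Y → (∀ A C → Closes A C → X ⊆ A ∪ C → (∀ v → v ∈ A → v ∉ Y) → # X ≤ # C) →
           ¬ ¬ Linkage X Y
  menger X Y separate k = hall R n L Q (≤-trans (#-mono {B = full} (λ _ _ → refl)) (≤-reflexive (#-full n))) cond λ where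
      (σ , ok , inj) → k record
        { next      = σ
        ; moves     = λ u p → moved (∨⁻ {u == σ u} (proj₁ (ok u (not⁺ p))))
        ; avoids    = λ u p → not⁻ (proj₂ (ok u (not⁺ p)))
        ; injective = λ u v p q → inj u v (not⁺ p) (not⁺ q)
        }
    where
    L Q : BSet n
    L v = not (Y v)
    Q v = not (X v)
    R : Fin n → BSet n
    R u v = (u == v) ∨ adj G u v
    moved : ∀ {u v} → (u == v) ≡ true ⊎ adj G u v ≡ true → v ≡ u ⊎ adj G u v ≡ true
    moved (inj₁ p) = inj₁ (≡-sym (==⁻ p))
    moved (inj₂ p) = inj₂ p
    cond : ∀ T → T ⊆ L → # T ≤ # (⋃ T R ∩ Q)
    cond T T⊆L = begin
      # T                               ≡⟨ #-split T X ⟩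
      # (T ∩ X) + # (T ∖ X)             ≤⟨ +-monoˡ-≤ _ T∩X≤ ⟩
      # ((N ∖ T) ∖ X) + # (T ∖ X)       ≤⟨ #-pack (λ v p → ∧⁺ (∧⁻ˡ {N v} (∧⁻ˡ p)) (∧⁻ʳ {N v ∧ _} p))
                                                  (λ v p → ∧⁺ (T⊆N v (∧⁻ˡ p)) (∧⁻ʳ {T v} p)) disjoint ⟩
      # (N ∩ Q)                         ∎
      where
      open ≤-Reasoning
      N = ⋃ T R
      C = (N ∪ X) ∖ T
      T⊆N : T ⊆ N
      T⊆N v p = ⋃⁺ {P = T} {R} v p (∨⁺ˡ (==⁺ refl))
      disjoint : ∀ v → v ∈ (N ∖ T) ∖ X → v ∉ T ∖ X
      disjoint v p rewrite not⁻ (∧⁻ʳ {N v} (∧⁻ˡ p)) = refl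
      C-cover : ∀ v → v ∈ C → v ∈ (N ∖ T) ∖ X ⊎ v ∈ X ∖ T
      C-cover v p with X v
      ... | true  = inj₂ (∧⁻ʳ {N v ∨ true} p)
      ... | false with N v
      ...   | true  = inj₁ (∧⁺ p refl)
      X⊆ : X ⊆ T ∪ C
      X⊆ v p with T v
      ... | true  = refl
      ... | false = ∧⁺ (∨⁺ʳ {N v} p) refl
      -- `T` avoids `Y`, so `separate` applies to `T` and `C`; then `X ∖ T` is cancelled from both
      -- sides.
      T∩X≤ : # (T ∩ X) ≤ # ((N ∖ T) ∖ X)
      T∩X≤ = +-cancelʳ-≤ (# (X ∖ T)) _ _ (begin
        # (T ∩ X) + # (X ∖ T)            ≤⟨ +-monoˡ-≤ _ (#-mono (λ v p → ∧⁺ (∧⁻ʳ {T v} p) (∧⁻ˡ p))) ⟩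
        # (X ∩ T) + # (X ∖ T)            ≡⟨ #-split X T ⟨
        # X                              ≤⟨ separate T C
                                              (λ u v p a q → ∧⁺ (∨⁺ˡ (⋃⁺ {P = T} {R} u p (∨⁺ʳ {u == v} a))) (not⁺ q))
                                              X⊆ (λ v p → not⁻ (T⊆L v p)) ⟩
        # C                              ≤⟨ #-cover C-cover ⟩
        # ((N ∖ T) ∖ X) + # (X ∖ T)      ∎)

  -- Boundaries and families of disjoint walks

  opaque
    ∂ : BSet n → BSet n → BSet n
    ∂ U A v = U v ∧ not (A v) ∧ ∃ᵇ (λ u → A u ∧ adj G u v)

    ∂⁺ : ∀ {U A} u {v} → v ∈ U → v ∉ A → u ∈ A → adj G u v ≡ true → v ∈ ∂ U A
    ∂⁺ u p q r a = ∧⁺ p (∧⁺ (not⁺ q) (∃ᵇ⁺ u (∧⁺ r a)))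

    ∂⊆ : ∀ {U A} → ∂ U A ⊆ U
    ∂⊆ v = ∧⁻ˡ

    ∂-out : ∀ {U A v} → v ∈ ∂ U A → v ∉ A
    ∂-out {U} {A} {v} p = not⁻ (∧⁻ˡ (∧⁻ʳ {U v} p))

    ∂-edge : ∀ {U A v} → v ∈ ∂ U A → ∃[ u ] u ∈ A × adj G u v ≡ true
    ∂-edge {U} {A} {v} p with ∃ᵇ⁻ (∧⁻ʳ {not (A v)} (∧⁻ʳ {U v} p))
    ... | u , q = u , ∧⁻ˡ q , ∧⁻ʳ {A u} q

  -- A walk may rest or revisit its own vertices; only walks with different starts in `P` have to be
  -- disjoint, at all pairs of times. `Simple` is kept apart because only unfinished walks need it.
  record Walks (P : BSet n) (o : Fin n → ℕ → Fin n) : Set where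
    field
      start    : ∀ x → o x 0 ≡ x
      walk     : ∀ x i → o x (suc i) ≡ o x i ⊎ adj G (o x i) (o x (suc i)) ≡ true
      disjoint : ∀ x y i j → x ∈ P → y ∈ P → o x i ≡ o y j → x ≡ y

  restrict : ∀ {P Q o} → Q ⊆ P → Walks P o → Walks Q o
  restrict sub w = record
    { start = start ; walk = walk ; disjoint = λ x y i j p q → disjoint x y i j (sub x p) (sub y q) }
    where open Walks w

  Simple : (Fin n → ℕ → Fin n) → ℕ → Fin n → Set
  Simple o ℓ x = ∀ i j → i ≤ ℓ → j ≤ ℓ → o x i ≡ o x j → i ≡ j

  opaque
    orbit : (Fin n → ℕ → Fin n) → ℕ → Fin n → BSet n
    orbit o ℓ x v = ∃ᵇ {suc ℓ} (λ i → o x (toℕ i) == v)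

    orbit⁺ : ∀ {o ℓ x i} → i ≤ ℓ → o x i ∈ orbit o ℓ x
    orbit⁺ {o} {ℓ} {x} p = ∃ᵇ⁺ {suc ℓ} (fromℕ< (s≤s p)) (==⁺ (cong (o x) (Fin.toℕ-fromℕ< (s≤s p))))

    orbit⁻ : ∀ {o ℓ x v} → v ∈ orbit o ℓ x → ∃[ i ] i ≤ ℓ × o x i ≡ v
    orbit⁻ {o} {ℓ} {x} p with ∃ᵇ⁻ {suc ℓ} p
    ... | i , q = toℕ i , s≤s⁻¹ (Fin.toℕ<n i) , ==⁻ q

    #-orbit-≤ : ∀ o ℓ x → # (orbit o ℓ x) ≤ suc ℓ
    #-orbit-≤ o ℓ x = ≤-trans (#-inj {Q = full {suc ℓ}} (λ v p → proj₁ (∃ᵇ⁻ {suc ℓ} p)) (λ _ _ → refl)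
      (λ u v p q eq → trans (≡-sym (==⁻ (proj₂ (∃ᵇ⁻ {suc ℓ} p))))
                     (trans (cong (o x ∘ toℕ) eq) (==⁻ (proj₂ (∃ᵇ⁻ {suc ℓ} q)))))) (≤-reflexive (#-full (suc ℓ)))

    #-orbit-≥ : ∀ o ℓ x → Simple o ℓ x → suc ℓ ≤ # (orbit o ℓ x)
    #-orbit-≥ o ℓ x simple = ≤-trans (≤-reflexive (≡-sym (#-full (suc ℓ))))
      (#-inj {P = full {suc ℓ}} (λ i _ → o x (toℕ i)) (λ i _ → orbit⁺ {o} {ℓ} {x} (s≤s⁻¹ (Fin.toℕ<n i)))
        (λ i j _ _ eq → Fin.toℕ-injective (simple _ _ (s≤s⁻¹ (Fin.toℕ<n i)) (s≤s⁻¹ (Fin.toℕ<n j)) eq)))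

  trace : BSet n → (Fin n → ℕ → Fin n) → ℕ → BSet n
  trace P o ℓ = ⋃ P (orbit o ℓ)

  #-trace-≤ : ∀ P o ℓ → # (trace P o ℓ) ≤ # P * suc ℓ
  #-trace-≤ P o ℓ = #-⋃-≤ P (orbit o ℓ) (suc ℓ) (λ x _ → #-orbit-≤ o ℓ x)

  #-trace-≥ : ∀ {P o} ℓ → Walks P o → (∀ x → x ∈ P → Simple o ℓ x) → # P * suc ℓ ≤ # (trace P o ℓ)
  #-trace-≥ {P} {o} ℓ w simple = #-⋃-≥ P (orbit o ℓ) (suc ℓ) (λ x p → #-orbit-≥ o ℓ x (simple x p))
    λ x y v p q r s → let i , _ , e = orbit⁻ {o} {ℓ} {x} r ; j , _ , e′ = orbit⁻ {o} {ℓ} {y} s in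
      Walks.disjoint w x y i j p q (trans e (≡-sym e′))

  trace⁺ : ∀ {P o ℓ x i} → x ∈ P → i ≤ ℓ → o x i ∈ trace P o ℓ
  trace⁺ {P} {o} {ℓ} {x} p q = ⋃⁺ {P = P} {orbit o ℓ} x p (orbit⁺ {o} {ℓ} {x} q)

  trace⁻ : ∀ {P o ℓ v} → v ∈ trace P o ℓ → ∃[ x ] ∃[ i ] x ∈ P × i ≤ ℓ × o x i ≡ v
  trace⁻ {P} {o} {ℓ} p with ⋃⁻ {P = P} {orbit o ℓ} p
  ... | x , q , r with orbit⁻ {o} {ℓ} {x} r
  ...   | i , s , e = x , i , q , s , e

  -- `∂` is an outer boundary: a walk leaving `A` hits it at the later vertex of the step, a walk
  -- entering `A` at the earlier one.
  crossing : ∀ {P o} → Walks P o → ∀ {ℓ U} A x → (∀ i → i ≤ ℓ → o x i ∈ U) →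
             ∀ b → b ≤ ℓ → A x ≢ A (o x b) → ∃[ i ] i ≤ ℓ × o x i ∈ ∂ U A
  crossing w A x inside zero b≤ neq = contradiction (cong A (≡-sym (Walks.start w x))) neq
  crossing {o = o} w {ℓ} {U} A x inside (suc b) b≤ neq with Walks.walk w x b
  ... | inj₁ eq = crossing w A x inside b (≤-trans (n≤1+n b) b≤) (neq ∘ λ e → trans e (cong A (≡-sym eq)))
  ... | inj₂ edge with A (o x b) in p | A (o x (suc b)) in q
  ...   | true  | false = suc b , b≤ , ∂⁺ (o x b) (inside _ b≤) q p edge
  ...   | false | true  = let b≤′ = ≤-trans (n≤1+n b) b≤ in
          b , b≤′ , ∂⁺ (o x (suc b)) (inside b b≤′) p q (trans (sym G _ _) edge)
  ...   | true  | true  = crossing w A x inside b (≤-trans (n≤1+n b) b≤) (neq ∘ λ e → trans e p)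
  ...   | false | false = crossing w A x inside b (≤-trans (n≤1+n b) b≤) (neq ∘ λ e → trans e p)

  #-crossing : ∀ {P o} → Walks P o → ∀ {ℓ U} A {D} → D ⊆ P → (∀ x i → x ∈ D → i ≤ ℓ → o x i ∈ U) →
               (∀ x → x ∈ D → ∃[ b ] b ≤ ℓ × A x ≢ A (o x b)) → # D ≤ # (∂ U A)
  #-crossing {P} {o} w {ℓ} {U} A {D} sub inside crosses =
    #-inj (λ x p → o x (proj₁ (found x p))) (λ x p → proj₂ (proj₂ (found x p)))
      (λ x y p q eq → Walks.disjoint w x y _ _ (sub x p) (sub y q) eq)
    where
    found : ∀ x → x ∈ D → ∃[ i ] i ≤ ℓ × o x i ∈ ∂ U A
    found x p = let b , b≤ , neq = crosses x p in crossing w A x (λ i → inside x i p) b b≤ neq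

  module _ {X Y} (link : Linkage X Y) where
    open Linkage link

    advance : Fin n → Fin n
    advance u = if Y u then u else next u

    follow : Fin n → ℕ → Fin n
    follow x zero    = x
    follow x (suc i) = advance (follow x i)

    private
      advance-in : ∀ {u} → u ∈ Y → advance u ≡ u
      advance-in p rewrite p = refl

      advance-out : ∀ {u} → u ∉ Y → advance u ≡ next u
      advance-out p rewrite p = refl

      no-return : ∀ {x} u → u ∉ Y → x ∈ X → ¬ x ≡ advance u
      no-return u u∉ x∈ eq =
        true≢false x∈ (trans (cong X (trans eq (advance-out u∉))) (avoids u u∉))

      advance-inj : ∀ u v → u ∉ Y → v ∉ Y → advance u ≡ advance v → u ≡ v
      advance-inj u v p q eq = injective u v p q (trans (≡-sym (advance-out p)) (trans eq (advance-out q)))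

      -- Both walks are traced back in parallel by injectivity. Steps spent waiting in `Y` are
      -- cancelled on one side at a time, and a start in `X` is never reached by a move from outside
      -- `Y`.
      disjoint : ∀ x y i j → x ∈ X → y ∈ X → follow x i ≡ follow y j → x ≡ y
      disjoint x y zero    zero    p q eq = eq
      disjoint x y zero    (suc j) p q eq =
        [ (λ r → disjoint x y zero j p q (trans eq (advance-in r)))
        , (λ r → contradiction eq (no-return (follow y j) r p)) ]′ (split (Y (follow y j)))
      disjoint x y (suc i) zero    p q eq =
        [ (λ r → disjoint x y i zero p q (trans (≡-sym (advance-in r)) eq))
        , (λ r → contradiction (≡-sym eq) (no-return (follow x i) r q)) ]′ (split (Y (follow x i)))
      disjoint x y (suc i) (suc j) p q eq =
        [ (λ r → disjoint x y i (suc j) p q (trans (≡-sym (advance-in r)) eq))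
        , (λ r → [ (λ s → disjoint x y (suc i) j p q (trans eq (advance-in s)))
                 , (λ s → disjoint x y i j p q (advance-inj _ _ r s eq)) ]′ (split (Y (follow y j))))
        ]′ (split (Y (follow x i)))

    follow-walks : Walks X follow
    follow-walks = record
      { start    = λ _ → refl
      ; walk     = walk
      ; disjoint = disjoint
      }
      where
      walk : ∀ x i → follow x (suc i) ≡ follow x i ⊎ adj G (follow x i) (follow x (suc i)) ≡ true
      walk x i with split (Y (follow x i))
      ... | inj₁ r = inj₁ (advance-in r)
      ... | inj₂ r rewrite r = moves (follow x i) r

    private
      stays : ∀ x {i ℓ} → i ≤ ℓ → follow x ℓ ∉ Y → follow x i ∉ Y
      stays x {i} {zero}  z≤n p = p
      stays x {i} {suc ℓ} i≤ p with m≤n⇒m<n∨m≡n i≤ | split (Y (follow x ℓ))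
      ... | inj₂ refl | _ = p
      ... | inj₁ i<   | inj₁ r = true≢false r (trans (cong Y (≡-sym (advance-in r))) p)
      ... | inj₁ (s≤s i≤ℓ) | inj₂ r = stays x i≤ℓ r

    -- Before reaching `Y` the walk is driven by the injection alone, so a repetition can be pulled
    -- back to a return to the start in `X`, which `next` avoids. Late walks of a linkage are
    -- therefore long simple paths.
    follow-simple : ∀ {x ℓ} → x ∈ X → follow x ℓ ∉ Y → Simple follow ℓ x
    follow-simple {x} {ℓ} x∈ out = go
      where
      go : Simple follow ℓ x
      go zero    zero    _ _ _ = refl
      go zero    (suc j) _ j≤ eq = contradiction eq (no-return _ (stays x (<⇒≤ j≤) out) x∈)
      go (suc i) zero    i≤ _ eq = contradiction (≡-sym eq) (no-return _ (stays x (<⇒≤ i≤) out) x∈)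
      go (suc i) (suc j) i≤ j≤ eq = cong suc (go i j (<⇒≤ i≤) (<⇒≤ j≤)
        (advance-inj _ _ (stays x (<⇒≤ i≤) out) (stays x (<⇒≤ j≤) out) eq))

-- Characters on a set of size 2 ^ h

-- The 2 ^ h − 1 nontrivial characters of (ℤ/2)^h.
Character : ℕ → Set
Character zero    = ⊥
Character (suc h) = ⊤ ⊎ (Bool × Character h)

sumᶜ : ∀ h → (Character h → ℕ) → ℕ
sumᶜ zero    f = 0
sumᶜ (suc h) f = f (inj₁ tt) + (sumᶜ h (λ c → f (inj₂ (true , c))) + sumᶜ h (λ c → f (inj₂ (false , c))))

sumᶜ-mono : ∀ h {f g} → (∀ c → f c ≤ g c) → sumᶜ h f ≤ sumᶜ h g
sumᶜ-mono zero    p = z≤n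
sumᶜ-mono (suc h) p = +-mono-≤ (p _) (+-mono-≤ (sumᶜ-mono h (λ c → p _)) (sumᶜ-mono h (λ c → p _)))

sumᶜ-cong : ∀ h {f g} → (∀ c → f c ≡ g c) → sumᶜ h f ≡ sumᶜ h g
sumᶜ-cong h p = ≤-antisym (sumᶜ-mono h (≤-reflexive ∘ p)) (sumᶜ-mono h (≤-reflexive ∘ ≡-sym ∘ p))

sumᶜ-+ : ∀ h f g → sumᶜ h (λ c → f c + g c) ≡ sumᶜ h f + sumᶜ h g
sumᶜ-+ zero    f g = refl
sumᶜ-+ (suc h) f g
  rewrite sumᶜ-+ h (λ c → f (inj₂ (true , c))) (λ c → g (inj₂ (true , c)))
        | sumᶜ-+ h (λ c → f (inj₂ (false , c))) (λ c → g (inj₂ (false , c))) = lemma (f _) (g _)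
      (sumᶜ h (λ c → f (inj₂ (true , c)))) (sumᶜ h (λ c → g (inj₂ (true , c))))
      (sumᶜ h (λ c → f (inj₂ (false , c)))) (sumᶜ h (λ c → g (inj₂ (false , c))))
  where
  lemma : ∀ a b c d e f → a + b + (c + d + (e + f)) ≡ a + (c + e) + (b + (d + f))
  lemma = solve-∀

-- The extra `x` stands for the trivial character, which the sum leaves out.
sumᶜ-const : ∀ h x → sumᶜ h (λ _ → x) + x ≡ 2 ^ h * x
sumᶜ-const zero    x = ≡-sym (+-identityʳ x)
sumᶜ-const (suc h) x = begin
  x + (s + s) + x        ≡⟨ lemma x s ⟩
  2 * (s + x)            ≡⟨ cong (2 *_) (sumᶜ-const h x) ⟩
  2 * (2 ^ h * x)        ≡⟨ *-assoc 2 (2 ^ h) x ⟨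
  2 ^ suc h * x          ∎
  where
  open ≡-Reasoning
  s = sumᶜ h (λ _ → x)
  lemma : ∀ x s → x + (s + s) + x ≡ 2 * (s + x)
  lemma = solve-∀

¬¬-choice : ∀ h {P : Character h → Set} → (∀ c → ¬ ¬ P c) → ¬ ¬ (∀ c → P c)
¬¬-choice zero    p k = k λ ()
¬¬-choice (suc h) p k = p (inj₁ tt) λ a → ¬¬-choice h (λ c → p (inj₂ (true , c))) λ b →
  ¬¬-choice h (λ c → p (inj₂ (false , c))) λ d →
  k λ { (inj₁ _) → a ; (inj₂ (true , c)) → b c ; (inj₂ (false , c)) → d c }

⋃ᶜ : ∀ h {n} → (Character h → BSet n) → BSet n
⋃ᶜ zero    S = none
⋃ᶜ (suc h) S = S (inj₁ tt) ∪ (⋃ᶜ h (λ c → S (inj₂ (true , c))) ∪ ⋃ᶜ h (λ c → S (inj₂ (false , c))))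

⋃ᶜ⁺ : ∀ h {n} {S : Character h → BSet n} c → S c ⊆ ⋃ᶜ h S
⋃ᶜ⁺ (suc h)         (inj₁ tt)          v p = ∨⁺ˡ p
⋃ᶜ⁺ (suc h) {S = S} (inj₂ (true , c))  v p = ∨⁺ʳ {S (inj₁ tt) v} (∨⁺ˡ (⋃ᶜ⁺ h c v p))
⋃ᶜ⁺ (suc h) {S = S} (inj₂ (false , c)) v p =
  ∨⁺ʳ {S (inj₁ tt) v} (∨⁺ʳ {⋃ᶜ h (λ c → S (inj₂ (true , c))) v} (⋃ᶜ⁺ h c v p))

#-⋃ᶜ : ∀ h {n} (S : Character h → BSet n) → # (⋃ᶜ h S) ≤ sumᶜ h (λ c → # (S c))
#-⋃ᶜ zero    {n} S = ≤-reflexive (#-none n)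
#-⋃ᶜ (suc h) S = ≤-trans (#-cover (λ v → ∨⁻)) (+-monoʳ-≤ _ (≤-trans (#-cover (λ v → ∨⁻))
  (+-mono-≤ (#-⋃ᶜ h _) (#-⋃ᶜ h _))))

opaque
  unfolding #_

  #-partition : ∀ {n} {A B C : BSet n} → (∀ v → ⟦ A v ⟧ ≡ ⟦ B v ⟧ + ⟦ C v ⟧) → # A ≡ # B + # C
  #-partition {B = B} {C} p = trans (sum-cong-≗ p) (∑-distrib-+ (λ v → ⟦ B v ⟧) (λ v → ⟦ C v ⟧))

  #-cong : ∀ {n} {A B : BSet n} → (∀ v → A v ≡ B v) → # A ≡ # B
  #-cong p = sum-cong-≗ (λ v → cong ⟦_⟧ (p v))

module _ {n : ℕ} where

  private
    in-count out-count : BSet n → BSet n → BSet n → ℕ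
    in-count  W χ A = # ((W ∩ χ) ∩ A)
    out-count W χ A = # ((W ∖ χ) ∩ A)

  -- Parseval's identity for the indicator of A ⊆ W, where the coefficient at χ is p − q with
  -- p, q counting A on the two sides of χ; both sides are moved so that no subtraction occurs.
  record Characters (h : ℕ) (W : BSet n) : Set where
    field
      χ        : Character h → BSet n
      balanced : ∀ c → # (W ∩ χ c) ≡ # (W ∖ χ c)
      parseval : ∀ A → sumᶜ h (λ c → in-count W (χ c) A * in-count W (χ c) A + out-count W (χ c) A * out-count W (χ c) A)
                         + # (W ∩ A) * # (W ∩ A)
                     ≡ sumᶜ h (λ c → 2 * (in-count W (χ c) A * out-count W (χ c) A)) + 2 ^ h * # (W ∩ A)

  private
    -- `s` is `id` for counts inside a glued character and `not` for counts outside it.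
    count-if : ∀ (s : Bool → Bool) w w₀ x y a → (w₀ ≡ true → w ≡ true) →
               ⟦ (w ∧ s (if w₀ then x else y)) ∧ a ⟧ ≡ ⟦ (w₀ ∧ s x) ∧ a ⟧ + ⟦ ((w ∧ not w₀) ∧ s y) ∧ a ⟧
    count-if s false true  x y a p = contradiction (p refl) λ ()
    count-if s true  true  x y a p = ≡-sym (+-identityʳ _)
    count-if s false false x y a p = refl
    count-if s true  false x y a p = refl

  -- Sylvester's doubling of Hadamard matrices. One new character is the cut of `W` into halves `W₀`
  -- and `W₁`; characters of equal index on the halves are glued in two ways, as they stand or with
  -- the second one negated. The parallelogram law then carries Parseval's identity from the halves
  -- to `W`.
  characters : ∀ h (W : BSet n) → # W ≡ 2 ^ h → Characters h W
  characters zero W eq = record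
    { χ = λ () ; balanced = λ () ; parseval = λ A → square≡ (≤-trans (#-mono (λ v → ∧⁻ˡ)) (≤-reflexive eq)) }
    where
    square≡ : ∀ {a} → a ≤ 1 → 0 + a * a ≡ 0 + 1 * a
    square≡ z≤n       = refl
    square≡ (s≤s z≤n) = refl
  characters (suc h) W eq with #-between none W (2 ^ h) (λ _ ()) (≤-trans (≤-reflexive (#-none n)) z≤n)
                                 (≤-trans (m≤m+n (2 ^ h) (1 * 2 ^ h)) (≤-reflexive (≡-sym eq)))
  ... | W₀ , _ , W₀⊆W , #W₀ = record
    { χ        = χ
    ; balanced = λ c → trans (#-cong (λ v → ≡-sym (∧-identityʳ _))) (trans (balanced c) (#-cong (λ v → ∧-identityʳ _)))
    ; parseval = parseval
    }
    where
    W₁ : BSet n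
    W₁ = W ∖ W₀
    W∩W₀ : ∀ v → W v ∧ W₀ v ≡ W₀ v
    W∩W₀ v with W₀ v in eq₀
    ... | true  = ∧⁺ (W₀⊆W v eq₀) refl
    ... | false with W v
    ...   | true  = refl
    ...   | false = refl
    #W₁ : # W₁ ≡ 2 ^ h
    #W₁ = +-cancelˡ-≡ (2 ^ h) _ _ (begin
      2 ^ h + # W₁           ≡⟨ cong (_+ # W₁) #W₀ ⟨
      # W₀ + # W₁            ≡⟨ cong (_+ # W₁) (#-cong W∩W₀) ⟨
      # (W ∩ W₀) + # W₁      ≡⟨ #-split W W₀ ⟨
      # W                    ≡⟨ eq ⟩
      2 ^ h + (2 ^ h + 0)    ≡⟨ cong (2 ^ h +_) (+-identityʳ _) ⟩
      2 ^ h + 2 ^ h          ∎)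
      where open ≡-Reasoning
    module C₀ = Characters (characters h W₀ #W₀)
    module C₁ = Characters (characters h W₁ #W₁)
    twist : Bool → Bool → Bool
    twist b x = if b then x else not x
    χ : Character (suc h) → BSet n
    χ (inj₁ _)       = W₀
    χ (inj₂ (b , c)) v = if W₀ v then C₀.χ c v else twist b (C₁.χ c v)

    p q p₀ q₀ p₁ q₁ : _ → BSet n → ℕ
    p  c = in-count W (χ c)
    q  c = out-count W (χ c)
    p₀ c = in-count W₀ (C₀.χ c)
    q₀ c = out-count W₀ (C₀.χ c)
    p₁ c = in-count W₁ (C₁.χ c)
    q₁ c = out-count W₁ (C₁.χ c)
    p-same : ∀ c A → p (inj₂ (true , c)) A ≡ p₀ c A + p₁ c A
    p-same c A = #-partition (λ v → count-if id (W v) (W₀ v) (C₀.χ c v) (C₁.χ c v) (A v) (W₀⊆W v))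
    q-same : ∀ c A → q (inj₂ (true , c)) A ≡ q₀ c A + q₁ c A
    q-same c A = #-partition (λ v → count-if not (W v) (W₀ v) (C₀.χ c v) (C₁.χ c v) (A v) (W₀⊆W v))
    p-cross : ∀ c A → p (inj₂ (false , c)) A ≡ p₀ c A + q₁ c A
    p-cross c A = #-partition (λ v → count-if id (W v) (W₀ v) (C₀.χ c v) (not (C₁.χ c v)) (A v) (W₀⊆W v))
    q-cross : ∀ c A → q (inj₂ (false , c)) A ≡ q₀ c A + p₁ c A
    q-cross c A = trans (#-partition (λ v → count-if not (W v) (W₀ v) (C₀.χ c v) (not (C₁.χ c v)) (A v) (W₀⊆W v)))
      (cong (q₀ c A +_) (#-cong (λ v → cong (λ x → ((W v ∧ not (W₀ v)) ∧ x) ∧ A v) (not-involutive (C₁.χ c v)))))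
    p-first : ∀ A → p (inj₁ tt) A ≡ # (W₀ ∩ A)
    p-first A = #-cong (λ v → cong (_∧ A v) (W∩W₀ v))
    total : ∀ A → # (W ∩ A) ≡ # (W₀ ∩ A) + # (W₁ ∩ A)
    total A = #-partition (λ v → pointwise (W v) (W₀ v) (A v) (W₀⊆W v))
      where
      pointwise : ∀ w w₀ a → (w₀ ≡ true → w ≡ true) → ⟦ w ∧ a ⟧ ≡ ⟦ w₀ ∧ a ⟧ + ⟦ (w ∧ not w₀) ∧ a ⟧
      pointwise false true  a p = contradiction (p refl) λ ()
      pointwise true  true  a p = ≡-sym (+-identityʳ _)
      pointwise false false a p = refl
      pointwise true  false a p = refl

    full-counts : ∀ (V X : BSet n) → # (V ∩ X) ≡ # (V ∖ X) → in-count V X full ≡ out-count V X full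
    full-counts V X eq = trans (#-cong (λ v → ∧-identityʳ _)) (trans eq (#-cong (λ v → ≡-sym (∧-identityʳ _))))

    balanced : ∀ c → p c full ≡ q c full
    balanced (inj₁ tt) = trans (p-first full) (begin
      # (W₀ ∩ full)     ≡⟨ #-cong (λ v → ∧-identityʳ _) ⟩
      # W₀              ≡⟨ #W₀ ⟩
      2 ^ h             ≡⟨ #W₁ ⟨
      # W₁              ≡⟨ #-cong (λ v → ∧-identityʳ _) ⟨
      # (W₁ ∩ full)     ∎)
      where open ≡-Reasoning
    balanced (inj₂ (true , c)) = trans (p-same c full) (trans
      (cong₂ _+_ (full-counts W₀ (C₀.χ c) (C₀.balanced c)) (full-counts W₁ (C₁.χ c) (C₁.balanced c))) (≡-sym (q-same c full)))
    balanced (inj₂ (false , c)) = trans (p-cross c full) (trans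
      (cong₂ _+_ (full-counts W₀ (C₀.χ c) (C₀.balanced c)) (≡-sym (full-counts W₁ (C₁.χ c) (C₁.balanced c)))) (≡-sym (q-cross c full)))

    parseval : ∀ A → sumᶜ (suc h) (λ c → p c A * p c A + q c A * q c A) + # (W ∩ A) * # (W ∩ A)
                   ≡ sumᶜ (suc h) (λ c → 2 * (p c A * q c A)) + 2 ^ suc h * # (W ∩ A)
    -- Adding `2 * X₀ + 2 * X₁` on both sides allows the subtraction-free forms of the parallelogram
    -- law and of both induction hypotheses to be substituted.
    parseval A rewrite p-first A | total A = +-cancelʳ-≡ (2 * X₀ + 2 * X₁) _ _ (begin
      a₀ * a₀ + a₁ * a₁ + (S₊ + S₋) + (a₀ + a₁) * (a₀ + a₁) + (2 * X₀ + 2 * X₁)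
        ≡⟨ shuffle₁ a₀ a₁ S₊ S₋ X₀ X₁ ⟩
      a₀ * a₀ + a₁ * a₁ + (a₀ + a₁) * (a₀ + a₁) + (S₊ + S₋ + 2 * X₀ + 2 * X₁)
        ≡⟨ cong (a₀ * a₀ + a₁ * a₁ + (a₀ + a₁) * (a₀ + a₁) +_) summed ⟩
      a₀ * a₀ + a₁ * a₁ + (a₀ + a₁) * (a₀ + a₁) + (X₊ + X₋ + 2 * S₀ + 2 * S₁)
        ≡⟨ shuffle₂ a₀ a₁ X₊ X₋ S₀ S₁ ⟩
      2 * (a₀ * a₁) + (X₊ + X₋) + (2 * (S₀ + a₀ * a₀) + 2 * (S₁ + a₁ * a₁))
        ≡⟨ cong (2 * (a₀ * a₁) + (X₊ + X₋) +_) (cong₂ (λ x y → 2 * x + 2 * y) (C₀.parseval A) (C₁.parseval A)) ⟩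
      2 * (a₀ * a₁) + (X₊ + X₋) + (2 * (X₀ + 2 ^ h * a₀) + 2 * (X₁ + 2 ^ h * a₁))
        ≡⟨ shuffle₃ a₀ a₁ X₊ X₋ X₀ X₁ (2 ^ h) ⟩
      2 * (a₀ * a₁) + (X₊ + X₋) + 2 ^ suc h * (a₀ + a₁) + (2 * X₀ + 2 * X₁) ∎)
      where
      open ≡-Reasoning
      a₀ = # (W₀ ∩ A)
      a₁ = # (W₁ ∩ A)
      sq cr : ℕ → ℕ → ℕ
      sq x y = x * x + y * y
      cr x y = 2 * (x * y)
      S₊ = sumᶜ h (λ c → sq (p (inj₂ (true , c)) A) (q (inj₂ (true , c)) A))
      S₋ = sumᶜ h (λ c → sq (p (inj₂ (false , c)) A) (q (inj₂ (false , c)) A))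
      X₊ = sumᶜ h (λ c → cr (p (inj₂ (true , c)) A) (q (inj₂ (true , c)) A))
      X₋ = sumᶜ h (λ c → cr (p (inj₂ (false , c)) A) (q (inj₂ (false , c)) A))
      S₀ = sumᶜ h (λ c → sq (p₀ c A) (q₀ c A))
      S₁ = sumᶜ h (λ c → sq (p₁ c A) (q₁ c A))
      X₀ = sumᶜ h (λ c → cr (p₀ c A) (q₀ c A))
      X₁ = sumᶜ h (λ c → cr (p₁ c A) (q₁ c A))
      shuffle₁ : ∀ a b s t x y → a * a + b * b + (s + t) + (a + b) * (a + b) + (2 * x + 2 * y)
                               ≡ a * a + b * b + (a + b) * (a + b) + (s + t + 2 * x + 2 * y)
      shuffle₁ = solve-∀
      shuffle₂ : ∀ a b x y s t → a * a + b * b + (a + b) * (a + b) + (x + y + 2 * s + 2 * t)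
                               ≡ 2 * (a * b) + (x + y) + (2 * (s + a * a) + 2 * (t + b * b))
      shuffle₂ = solve-∀
      shuffle₃ : ∀ a b x y z u w → 2 * (a * b) + (x + y) + (2 * (z + w * a) + 2 * (u + w * b))
                                 ≡ 2 * (a * b) + (x + y) + 2 * w * (a + b) + (2 * z + 2 * u)
      shuffle₃ = solve-∀
      -- `sq` minus `cr` is the square of a difference. With α = x - y and β = z - u this is (α +
      -- β)² + (α - β)² = 2α² + 2β², with the negative terms moved across.
      parallelogram : ∀ x y z u → sq (x + z) (y + u) + sq (x + u) (y + z) + (cr x y + cr x y) + (cr z u + cr z u)
                                ≡ cr (x + z) (y + u) + cr (x + u) (y + z) + (sq x y + sq x y) + (sq z u + sq z u)
      parallelogram = expanded
        where
        expanded : ∀ x y z u →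
          (x + z) * (x + z) + (y + u) * (y + u) + ((x + u) * (x + u) + (y + z) * (y + z))
            + (2 * (x * y) + 2 * (x * y)) + (2 * (z * u) + 2 * (z * u))
          ≡ 2 * ((x + z) * (y + u)) + 2 * ((x + u) * (y + z))
            + (x * x + y * y + (x * x + y * y)) + (z * z + u * u + (z * z + u * u))
        expanded = solve-∀
      linear : ∀ f g k l → sumᶜ h (λ c → f c + g c + (k c + k c) + (l c + l c))
                         ≡ sumᶜ h f + sumᶜ h g + 2 * sumᶜ h k + 2 * sumᶜ h l
      linear f g k l
        rewrite sumᶜ-+ h (λ c → f c + g c + (k c + k c)) (λ c → l c + l c)
              | sumᶜ-+ h (λ c → f c + g c) (λ c → k c + k c) | sumᶜ-+ h f g | sumᶜ-+ h k k | sumᶜ-+ h l l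
              | +-identityʳ (sumᶜ h k) | +-identityʳ (sumᶜ h l) = refl
      pointwise : ∀ c →
        sq (p (inj₂ (true , c)) A) (q (inj₂ (true , c)) A) + sq (p (inj₂ (false , c)) A) (q (inj₂ (false , c)) A)
          + (cr (p₀ c A) (q₀ c A) + cr (p₀ c A) (q₀ c A)) + (cr (p₁ c A) (q₁ c A) + cr (p₁ c A) (q₁ c A))
        ≡ cr (p (inj₂ (true , c)) A) (q (inj₂ (true , c)) A) + cr (p (inj₂ (false , c)) A) (q (inj₂ (false , c)) A)
          + (sq (p₀ c A) (q₀ c A) + sq (p₀ c A) (q₀ c A)) + (sq (p₁ c A) (q₁ c A) + sq (p₁ c A) (q₁ c A))
      pointwise c rewrite p-same c A | q-same c A | p-cross c A | q-cross c A =
        parallelogram (p₀ c A) (q₀ c A) (p₁ c A) (q₁ c A)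
      summed : S₊ + S₋ + 2 * X₀ + 2 * X₁ ≡ X₊ + X₋ + 2 * S₀ + 2 * S₁
      summed = trans (≡-sym (linear _ _ _ _)) (trans (sumᶜ-cong h pointwise) (linear _ _ _ _))

  -- Parseval equates the sum of the squared coefficients with `w * a` minus `a * a`, that is, with
  -- `a * b`, so `a * b` is at most `w * (D * D)`. The larger of `a` and `b` is at least half of
  -- `w`, which bounds the smaller one by `2 * (D * D)`.
  discrepancy : ∀ {h W} (C : Characters h W) → # W ≡ 2 ^ h → ∀ A D →
    (∀ c → # ((W ∩ Characters.χ C c) ∩ A) ≤ # ((W ∖ Characters.χ C c) ∩ A) + D × # ((W ∖ Characters.χ C c) ∩ A) ≤ # ((W ∩ Characters.χ C c) ∩ A) + D) →
    # (W ∩ A) ≤ 2 * (D * D) ⊎ # (W ∖ A) ≤ 2 * (D * D)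
  discrepancy {h} {W} C #W A D close = conclude (≤-total a b)
    where
    open Characters C
    open ≤-Reasoning
    a = # (W ∩ A)
    b = # (W ∖ A)
    w = 2 ^ h
    w≡ : w ≡ a + b
    w≡ = trans (≡-sym #W) (#-split W A)
    squares : ∀ {p q} → p ≤ q → q ≤ p + D → p * p + q * q ≤ 2 * (p * q) + D * D
    squares {p} p≤q q≤ with m≤n⇒∃[o]m+o≡n p≤q
    ... | d , refl = begin
      p * p + (p + d) * (p + d)       ≡⟨ lemma p d ⟩
      2 * (p * (p + d)) + d * d       ≤⟨ +-monoʳ-≤ _ (*-mono-≤ d≤ d≤) ⟩
      2 * (p * (p + d)) + D * D       ∎
      where
      d≤ = +-cancelˡ-≤ p d D q≤
      lemma : ∀ p d → p * p + (p + d) * (p + d) ≡ 2 * (p * (p + d)) + d * d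
      lemma = solve-∀
    squares′ : ∀ {p q} → p ≤ q + D → q ≤ p + D → p * p + q * q ≤ 2 * (p * q) + D * D
    squares′ {p} {q} p≤ q≤ with ≤-total p q
    ... | inj₁ le = squares le q≤
    ... | inj₂ le = ≤-trans (≤-reflexive (+-comm (p * p) (q * q)))
            (≤-trans (squares le p≤) (≤-reflexive (cong (λ x → 2 * x + D * D) (*-comm q p))))
    product : a * b ≤ w * (D * D)
    product = +-cancelˡ-≤ (X + a * a) _ _ (begin
      X + a * a + a * b                     ≡⟨ lemma X a b ⟩
      X + (a + b) * a                       ≡⟨ cong (λ x → X + x * a) w≡ ⟨
      X + w * a                             ≡⟨ parseval A ⟨
      sumᶜ h _ + a * a                      ≤⟨ +-monoˡ-≤ (a * a) (sumᶜ-mono h (λ c → squares′ (proj₁ (close c)) (proj₂ (close c)))) ⟩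
      sumᶜ h (λ c → f c + D * D) + a * a    ≡⟨ cong (_+ a * a) (sumᶜ-+ h f (λ _ → D * D)) ⟩
      X + sumᶜ h (λ _ → D * D) + a * a      ≤⟨ +-monoˡ-≤ (a * a) (+-monoʳ-≤ X (≤-trans (m≤m+n _ (D * D)) (≤-reflexive (sumᶜ-const h (D * D))))) ⟩
      X + w * (D * D) + a * a               ≡⟨ lemma′ X (w * (D * D)) (a * a) ⟩
      X + a * a + w * (D * D)               ∎)
      where
      f : Character h → ℕ
      f c = 2 * (# ((W ∩ χ c) ∩ A) * # ((W ∖ χ c) ∩ A))
      X = sumᶜ h f
      lemma : ∀ X a b → X + a * a + a * b ≡ X + (a + b) * a
      lemma = solve-∀
      lemma′ : ∀ x y z → x + y + z ≡ x + z + y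
      lemma′ = solve-∀
    half : ∀ {x y} → x ≤ y → x * y ≤ (x + y) * (D * D) → x ≤ 2 * (D * D)
    half {x} {y} x≤y prod = ≮⇒≥ λ gt → <-irrefl refl (begin-strict
      x * y                      ≤⟨ prod ⟩
      (x + y) * (D * D)          ≤⟨ *-monoˡ-≤ (D * D) (+-monoˡ-≤ y x≤y) ⟩
      (y + y) * (D * D)          ≡⟨ lemma y (D * D) ⟩
      2 * (D * D) * y            <⟨ m<n+m _ (≤-trans (s≤s z≤n) (≤-trans gt x≤y)) ⟩
      (1 + 2 * (D * D)) * y      ≤⟨ *-monoˡ-≤ y gt ⟩
      x * y                      ∎)
      where
      lemma : ∀ y d → (y + y) * d ≡ 2 * d * y
      lemma = solve-∀
    conclude : a ≤ b ⊎ b ≤ a → a ≤ 2 * (D * D) ⊎ b ≤ 2 * (D * D)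
    conclude (inj₁ le) = inj₁ (half le (≤-trans product (≤-reflexive (cong (_* (D * D)) w≡))))
    conclude (inj₂ le) = inj₂ (half le (≤-trans (≤-reflexive (*-comm b a))
      (≤-trans product (≤-reflexive (cong (_* (D * D)) (trans w≡ (+-comm a b)))))))

-- Tangles

module _ {n} (G : Graph n) where

  opaque
    far : BSet n → BSet n → BSet n
    far U A = U ∖ (A ∪ ∂ G U A)

    far⁺ : ∀ {U A v} → v ∈ U → v ∉ A → v ∉ ∂ G U A → v ∈ far U A
    far⁺ p q r rewrite p | q | r = refl

    far-out : ∀ {U A v} → v ∈ far U A → v ∉ A
    far-out {U} {A} {v} p with A v | not⁻ {A v ∨ _} (∧⁻ʳ {U v} p)
    ... | false | _ = refl

    far-out∂ : ∀ {U A v} → v ∈ far U A → v ∉ ∂ G U A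
    far-out∂ {U} {A} {v} p with A v | not⁻ {A v ∨ _} (∧⁻ʳ {U v} p)
    ... | false | q = q

    far⊆ : ∀ {U A} → far U A ⊆ U
    far⊆ v = ∧⁻ˡ

  -- A vertex of `A` next to the far side would put its far neighbour into `∂ G U A`. Both sides of
  -- a separation thus fall under the same statements about sets with small boundary.
  ∂-far : ∀ {U A} → ∂ G U (far U A) ⊆ ∂ G U A
  ∂-far {U} {A} v p with split (∂ G U A v) | split (A v) | ∂-edge G p
  ... | inj₁ q | _      | _ = q
  ... | inj₂ q | inj₂ r | _ = true≢false (far⁺ (∂⊆ G v p) r q) (∂-out G p)
  ... | inj₂ q | inj₁ r | u , u∈ , uv = true≢false
        (∂⁺ G v (far⊆ u u∈) (far-out u∈) r (trans (sym G v u) uv)) (far-out∂ u∈)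

  ∂-restrict : ∀ {U U′ A} → U ⊆ U′ → ∂ G U (A ∩ U) ⊆ ∂ G U′ A
  ∂-restrict {U} {U′} {A} sub v p with ∂-edge G p
  ... | u , u∈ , uv = ∂⁺ G u (sub v (∂⊆ G v p)) outside (∧⁻ˡ u∈) uv
    where
    outside : v ∉ A
    outside with A v | ∂-out G p
    ... | false | _ = refl
    ... | true  | q = true≢false (∂⊆ G v p) q

  ∂-sub : ∀ {U U′ B} → B ⊆ U′ → ∀ v → v ∈ ∂ G U B → v ∈ ∂ G U′ B ⊎ v ∈ ∂ G U U′
  ∂-sub {U} {U′} {B} sub v p with ∂-edge G p | split (U′ v)
  ... | u , u∈ , uv | inj₁ q = inj₁ (∂⁺ G u q (∂-out G p) u∈ uv)
  ... | u , u∈ , uv | inj₂ q = inj₂ (∂⁺ G u (∂⊆ G v p) q (sub u u∈) uv)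

  #-far : ∀ {U A} → A ⊆ U → # A + # (far U A) ≤ # U
  #-far {U} {A} sub = #-pack sub far⊆ disjoint
    where
    disjoint : ∀ v → v ∈ A → v ∉ far U A
    disjoint v p = ¬-not λ q → true≢false p (far-out q)

  far-cover : ∀ {U A} v → v ∈ U → v ∈ A ⊎ v ∈ ∂ G U A ∪ far U A
  far-cover {U} {A} v p with split (A v) | split (∂ G U A v)
  ... | inj₁ q | _      = inj₁ q
  ... | inj₂ q | inj₁ r = inj₂ (∨⁺ˡ r)
  ... | inj₂ q | inj₂ r = inj₂ (∨⁺ʳ {∂ G U A v} (far⁺ p q r))

  Sweepable : ℕ → Set
  Sweepable k = ∀ U τ → 1 ≤ τ → τ ≤ # U →
    ∃[ A ] A ⊆ U × τ ≤ # A × # A ≤ τ + k × # (∂ G U A) ≤ k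

  -- Vertices of `W` in `C` outside `A` count on both sides. In this form a failure keeps the
  -- interfaces of both pieces at size at most `# W` when a tree decomposition is built.
  WellLinked : ℕ → BSet n → Set
  WellLinked θ W = ∀ A C → Closes G A C → # C ≤ θ → # (W ∩ (A ∪ C)) ≤ # C ⊎ # (W ∖ A) ≤ # C

  -- Long walks attached to anchored sets

  module _ (k : ℕ) (sweep : Sweepable k) where

    -- A tangle-like property weak enough to pass from a free set to the ends of disjoint walks
    -- starting in it, at the price of a larger `ε`.
    Anchored : ℕ → BSet n → BSet n → Set
    Anchored ε U Y = ∀ A → A ⊆ U → # (∂ G U A) ≤ k → # (Y ∩ A) ≤ ε ⊎ # (Y ∩ far U A) ≤ ε

    -- Many long disjoint walks hanging from an anchored set dominate the size of the union,
    -- and a small boundary leaves almost all of them on one side.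
    no-hairs : ∀ {ε U Y P o ℓ} → Anchored ε U Y → Y ⊆ U → P ⊆ Y → Walks G P o →
               (∀ x → x ∈ P → Simple G o ℓ x) → # U ≤ suc ℓ → # P < 4 + 2 * ε + 4 * k
    no-hairs {ε} {U} {Y} {P} {o} {ℓ} anchored Y⊆U P⊆Y walks simple U≤L = ≰⇒> impossible
      where
      open ≤-Reasoning
      L = suc ℓ
      T = trace G P o ℓ
      U′ = U ∪ T
      T≤ : # T ≤ # U′
      T≤ = #-mono (λ v → ∨⁺ʳ {U v})
      -- A walk meeting `B` either starts in `B`, which happens at most `ε` times, or crosses the
      -- boundary, at most `k` times. `U` itself contributes at most one more `L`.
      one-sided : ∀ B → B ⊆ U′ → # (∂ G U′ B) ≤ k → # (P ∩ B) ≤ ε → # B ≤ (1 + (ε + k)) * L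
      one-sided B B⊆ small few = begin
        # B                           ≤⟨ #-cover cover ⟩
        # U + # (trace G P′ o ℓ)      ≤⟨ +-mono-≤ U≤L (#-trace-≤ G P′ o ℓ) ⟩
        L + # P′ * L                  ≤⟨ +-monoʳ-≤ L (*-monoˡ-≤ L P′≤) ⟩
        (1 + (ε + k)) * L             ∎
        where
        meets P′ D : BSet n
        meets x = ∃ᵇ (λ v → orbit G o ℓ x v ∧ B v)
        P′ = P ∩ meets
        D = P′ ∖ B
        cover : ∀ v → v ∈ B → v ∈ U ⊎ v ∈ trace G P′ o ℓ
        cover v p with ∨⁻ {U v} (B⊆ v p)
        ... | inj₁ q = inj₁ q
        ... | inj₂ q with trace⁻ G q
        ...   | x , i , x∈ , i≤ , refl = inj₂ (trace⁺ G (∧⁺ x∈ (∃ᵇ⁺ v (∧⁺ (orbit⁺ G i≤) p))) i≤)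
        crosses : ∀ x → x ∈ D → ∃[ b ] b ≤ ℓ × B x ≢ B (o x b)
        crosses x p with ∃ᵇ⁻ (∧⁻ʳ {P x} (∧⁻ˡ p))
        ... | v , q with orbit⁻ G (∧⁻ˡ q)
        ...   | b , b≤ , refl = b , b≤ , λ e →
                true≢false (∧⁻ʳ {orbit G o ℓ x v} q) (trans (≡-sym e) (not⁻ (∧⁻ʳ {P′ x} p)))
        P′≤ : # P′ ≤ ε + k
        P′≤ = begin
          # P′                  ≤⟨ #-cover split-P′ ⟩
          # (P ∩ B) + # D       ≤⟨ +-mono-≤ few (≤-trans (#-crossing G walks B
                                     (λ x → ∧⁻ˡ ∘ ∧⁻ˡ {P x ∧ meets x})
                                     (λ x i p i≤ → ∨⁺ʳ {U (o x i)} (trace⁺ G (∧⁻ˡ (∧⁻ˡ {P x ∧ meets x} p)) i≤)) crosses) small) ⟩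
          ε + k                 ∎
          where
          split-P′ : ∀ x → x ∈ P′ → x ∈ P ∩ B ⊎ x ∈ D
          split-P′ x p with B x
          ... | true  = inj₁ (∧⁺ (∧⁻ˡ p) refl)
          ... | false = inj₂ (∧⁺ p refl)
      impossible : ¬ 4 + 2 * ε + 4 * k ≤ # P
      -- The target is one `L` above the bound of `one-sided`, so `A` cannot be the side with few
      -- starts. If the far side is, then `A`, the boundary and the far side together stay below
      -- `(4 + 2 * ε + 4 * k) * L`, which is the origin of that constant.
      impossible many with sweep U′ ((2 + (ε + k)) * L) (s≤s z≤n) (begin
          (2 + (ε + k)) * L              ≤⟨ *-monoˡ-≤ L (≤-trans (m≤m+n (2 + (ε + k)) (2 + ε + 3 * k))
                                              (≤-reflexive (lemma ε k))) ⟩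
          (4 + 2 * ε + 4 * k) * L        ≤⟨ *-monoˡ-≤ L many ⟩
          # P * L                        ≤⟨ #-trace-≥ G ℓ walks simple ⟩
          # T                            ≤⟨ T≤ ⟩
          # U′                           ∎)
        where
        lemma : ∀ ε k → 2 + (ε + k) + (2 + ε + 3 * k) ≡ 4 + 2 * ε + 4 * k
        lemma = solve-∀
      ... | A , A⊆ , A≥ , A≤ , ∂A≤ with anchored (A ∩ U) (λ v → ∧⁻ʳ {A v})
              (≤-trans (#-mono (∂-restrict {U} {U′} {A} (λ v → ∨⁺ˡ))) ∂A≤)
      ...   | inj₁ few = <-irrefl refl (begin-strict
          # A                            ≤⟨ one-sided A A⊆ ∂A≤ (≤-trans (#-mono (λ v p → ∧⁺ (P⊆Y v (∧⁻ˡ p))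
                                              (∧⁺ (∧⁻ʳ {P v} p) (Y⊆U v (P⊆Y v (∧⁻ˡ p)))))) few) ⟩
          (1 + (ε + k)) * L              <⟨ m<n+m _ {L} (s≤s z≤n) ⟩
          (2 + (ε + k)) * L              ≤⟨ A≥ ⟩
          # A                            ∎)
      ...   | inj₂ few = <-irrefl refl (begin-strict
          # P * L                                          ≤⟨ #-trace-≥ G ℓ walks simple ⟩
          # T                                              ≤⟨ T≤ ⟩
          # U′                                             ≤⟨ ≤-trans (#-cover (far-cover {U′} {A}))
                                                                (+-monoʳ-≤ _ (#-cover (λ v → ∨⁻))) ⟩
          # A + (# (∂ G U′ A) + # (far U′ A))              ≤⟨ +-mono-≤ A≤ (+-mono-≤ ∂A≤ far≤) ⟩
          (2 + (ε + k)) * L + k + (k + (1 + (ε + k)) * L)  ≤⟨ +-mono-≤ (+-monoʳ-≤ ((2 + (ε + k)) * L) (m≤m*n k L))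
                                                                (+-monoˡ-≤ ((1 + (ε + k)) * L) (m≤m*n k L)) ⟩
          (2 + (ε + k)) * L + k * L + (k * L + (1 + (ε + k)) * L)
                                                           <⟨ m<m+n _ {L} (s≤s z≤n) ⟩
          (2 + (ε + k)) * L + k * L + (k * L + (1 + (ε + k)) * L) + L
                                                           ≡⟨ lemma ε k L ⟩
          (4 + 2 * ε + 4 * k) * L                          ≤⟨ *-monoˡ-≤ L many ⟩
          # P * L                                          ∎)
        where
        lemma : ∀ ε k L → (2 + (ε + k)) * L + k * L + (k * L + (1 + (ε + k)) * L) + L ≡ (4 + 2 * ε + 4 * k) * L
        lemma = solve-∀
        far≤ : # (far U′ A) ≤ (1 + (ε + k)) * L
        far≤ = one-sided (far U′ A) far⊆ (≤-trans (#-mono ∂-far) ∂A≤) (≤-trans (#-mono inside) few)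
          where
          inside : P ∩ far U′ A ⊆ Y ∩ far U (A ∩ U)
          inside v p = ∧⁺ y (far⁺ (Y⊆U v y) (¬-not λ q → true≢false (∧⁻ˡ q) (far-out (∧⁻ʳ {P v} p)))
              (¬-not λ q → true≢false (∂-restrict {U} {U′} {A} (λ v → ∨⁺ˡ) v q) (far-out∂ (∧⁻ʳ {P v} p))))
            where y = P⊆Y v (∧⁻ˡ p)

    -- Tangles and their free sets

    module _ (W : BSet n) (e : ℕ) where

      -- `room` says that the part of `W` outside `U`, two small sides and a separator of order `t`
      -- never cover `W`; this makes the orientation of separations consistent.
      record Tangle (t : ℕ) (U : BSet n) : Set where
        field
          room    : 3 * e + t < # W
          large   : # (W ∖ U) ≤ e
          decides : ∀ A → A ⊆ U → # (∂ G U A) ≤ t → # (W ∩ A) ≤ e ⊎ # (W ∖ A) ≤ e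

      module _ {t U} (tangle : Tangle t U) where
        open Tangle tangle

        private
          e+e+e : e + e + e ≡ 3 * e
          e+e+e = lemma e
            where
            lemma : ∀ e → e + e + e ≡ 3 * e
            lemma = solve-∀

        W-covered : ∀ {A B C} → (∀ v → v ∈ W → v ∈ W ∖ U ⊎ v ∈ A ∪ (B ∪ C)) →
                    # A ≤ e → # B ≤ e → # C ≤ t → ⊥
        W-covered {A} {B} {C} cover a b c = <-irrefl refl (begin-strict
          # W                                 ≤⟨ #-cover cover ⟩
          # (W ∖ U) + # (A ∪ (B ∪ C))         ≤⟨ +-mono-≤ large (≤-trans (#-cover (λ v → ∨⁻))
                                                   (+-monoʳ-≤ _ (#-cover (λ v → ∨⁻)))) ⟩
          e + (# A + (# B + # C))             ≤⟨ +-monoʳ-≤ e (+-mono-≤ a (+-mono-≤ b c)) ⟩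
          e + (e + (e + t))                   ≡⟨ lemma e t ⟩
          3 * e + t                           <⟨ room ⟩
          # W                                 ∎)
          where
          open ≤-Reasoning
          lemma : ∀ e t → e + (e + (e + t)) ≡ 3 * e + t
          lemma = solve-∀

        far-large : ∀ {A} → A ⊆ U → # (∂ G U A) ≤ t → # (W ∩ A) ≤ e → # (W ∖ far U A) ≤ e
        far-large {A} A⊆ ∂≤ small with decides (far U A) far⊆ (≤-trans (#-mono ∂-far) ∂≤)
        ... | inj₂ p = p
        ... | inj₁ p = ⊥-elim (W-covered cover small p ∂≤)
          where
          cover : ∀ v → v ∈ W → v ∈ W ∖ U ⊎ v ∈ (W ∩ A) ∪ ((W ∩ far U A) ∪ ∂ G U A)
          cover v w with split (U v)
          ... | inj₂ q = inj₁ (∧⁺ w (not⁺ q))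
          ... | inj₁ q with far-cover {U} {A} v q
          ...   | inj₁ a = inj₂ (∨⁺ˡ (∧⁺ w a))
          ...   | inj₂ r with ∨⁻ {∂ G U A v} r
          ...     | inj₁ d = inj₂ (∨⁺ʳ {W v ∧ A v} (∨⁺ʳ {W v ∧ far U A v} d))
          ...     | inj₂ f = inj₂ (∨⁺ʳ {W v ∧ A v} (∨⁺ˡ (∧⁺ w f)))

        far-small : ∀ {A} → # (W ∖ A) ≤ e → # (W ∩ far U A) ≤ e
        far-small {A} big = ≤-trans (#-mono (λ v p → ∧⁺ (∧⁻ˡ p) (not⁺ (far-out (∧⁻ʳ {W v} p))))) big

        join-small : ∀ {A B} → A ⊆ U → B ⊆ U → # (∂ G U (A ∪ B)) ≤ t →
                     # (W ∩ A) ≤ e → # (W ∩ B) ≤ e → # (W ∩ (A ∪ B)) ≤ e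
        join-small {A} {B} A⊆ B⊆ ∂≤ a b with decides (A ∪ B) (λ v p → [ A⊆ v , B⊆ v ]′ (∨⁻ p)) ∂≤
        ... | inj₁ p = p
        ... | inj₂ p = contradiction (≤-trans room (begin
            # W                                          ≡⟨ #-split W (A ∪ B) ⟩
            # (W ∩ (A ∪ B)) + # (W ∖ (A ∪ B))            ≤⟨ +-mono-≤ (#-cover cover) p ⟩
            # (W ∩ A) + # (W ∩ B) + e                    ≤⟨ +-monoˡ-≤ e (+-mono-≤ a b) ⟩
            e + e + e                                    ≡⟨ e+e+e ⟩
            3 * e                                        ≤⟨ m≤m+n _ t ⟩
            3 * e + t                                    ∎)) (<-irrefl refl)
          where
          open ≤-Reasoning
          cover : ∀ v → v ∈ W ∩ (A ∪ B) → v ∈ W ∩ A ⊎ v ∈ W ∩ B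
          cover v p with ∨⁻ {A v} (∧⁻ʳ {W v} p)
          ... | inj₁ q = inj₁ (∧⁺ (∧⁻ˡ p) q)
          ... | inj₂ q = inj₂ (∧⁺ (∧⁻ˡ p) q)

        -- Independence with respect to the tangle, in exchange form: vertices of `F` inside a small
        -- side `A` cannot be traded for at most as many vertices of a separator around `A`.
        Free : ℕ → BSet n → Set
        Free r F = F ⊆ U × # F ≡ r ×
          (∀ A S → A ⊆ U → S ⊆ U → ∂ G U A ⊆ S → # (W ∩ A) ≤ e → 1 ≤ # (F ∩ A) → ¬ # (S ∖ F) ≤ # (F ∩ A))

        private
          record Separation (r : ℕ) (A S : BSet n) : Set where
            field
              A⊆U      : A ⊆ U
              S⊆U      : S ⊆ U
              boundary : ∂ G U A ⊆ S
              disjoint : ∀ v → v ∈ S → v ∉ A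
              small    : # (W ∩ A) ≤ e
              order    : # S ≤ r

          -- Moving `c` vertices from the separator into the small side gains `2 * c` and costs at
          -- most `c`. The factor 2 makes this an improvement, as is adding a vertex to the
          -- separator.
          weight : BSet n → BSet n → ℕ
          weight A S = 2 * # A + # S

          weight≤ : ∀ {r A S} → Separation r A S → weight A S ≤ 2 * # U + r
          weight≤ s = +-mono-≤ (*-monoʳ-≤ 2 (#-mono (Separation.A⊆U s))) (Separation.order s)

          -- By `room` some vertex of `W` in `U` lies beyond `A` and `S`, and it may join the
          -- separator.
          enlarge : ∀ {r A S} → r ≤ t → Separation r A S → # S < r →
                    ∃[ S′ ] Separation r A S′ × weight A S < weight A S′
          enlarge {r} {A} {S} r≤t sep S<r with #-inhabited {A = W ∩ far′} (n≢0⇒n>0 λ z → W-covered cover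
              small (≤-trans (≤-reflexive z) z≤n) (≤-trans order r≤t))
            where
            open Separation sep
            far′ = U ∖ (A ∪ S)
            cover : ∀ v → v ∈ W → v ∈ W ∖ U ⊎ v ∈ (W ∩ A) ∪ ((W ∩ far′) ∪ S)
            cover v w with U v | A v | S v
            ... | false | _     | _     rewrite w = inj₁ refl
            ... | true  | true  | _     rewrite w = inj₂ refl
            ... | true  | false | true  rewrite w = inj₂ refl
            ... | true  | false | false rewrite w = inj₂ refl
          ... | v , p = S ∪ (_== v) , record
              { A⊆U = A⊆U
              ; S⊆U = λ u q → [ S⊆U u , (λ r → subst (_∈ U) (≡-sym (==⁻ r)) v∈U) ]′ (∨⁻ q)
              ; boundary = λ u → ∨⁺ˡ ∘ boundary u
              ; disjoint = λ u q → [ disjoint u , (λ r → subst (_∉ A) (≡-sym (==⁻ r)) v∉A) ]′ (∨⁻ q)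
              ; small = small
              ; order = ≤-trans (≤-trans (#-cover (λ u → ∨⁻)) (≤-trans (+-monoʳ-≤ _ (≤-trans
                  (#-unique (λ a b x y → trans (==⁻ x) (≡-sym (==⁻ y)))) (⟦⟧-mono {b = true} (λ _ → refl))))
                  (≤-reflexive (+-comm (# S) 1)))) S<r
              } , +-monoʳ-< (2 * # A) (≤-trans (≤-trans (≤-reflexive (+-comm 1 (# S))) (+-monoʳ-≤ (# S) (#-member v (==⁺ refl))))
                    (#-pack (λ u → ∨⁺ˡ) (λ u → ∨⁺ʳ {S u})
                      (λ u q → ¬-not λ r → true≢false q (subst (_∉ S) (≡-sym (==⁻ r)) v∉S))))
            where
            open Separation sep
            far′ = U ∖ (A ∪ S)
            v∈U = ∧⁻ˡ (∧⁻ʳ {W v} p)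
            v∉A : v ∉ A
            v∉A with A v | not⁻ {A v ∨ _} (∧⁻ʳ {U v} (∧⁻ʳ {W v} p))
            ... | false | _ = refl
            v∉S : v ∉ S
            v∉S with A v | not⁻ {A v ∨ _} (∧⁻ʳ {U v} (∧⁻ʳ {W v} p))
            ... | false | q = q

          -- A violation of freeness improves the separation: `A` joins the small side, and the
          -- vertices of `F` swallowed by it are replaced by the no more numerous vertices of
          -- `S ∖ F`.
          absorb : ∀ {r A₀ F} → r ≤ t → Separation r A₀ F →
                   ∀ A S → A ⊆ U → S ⊆ U → ∂ G U A ⊆ S → # (W ∩ A) ≤ e →
                   1 ≤ # (F ∩ A) → # (S ∖ F) ≤ # (F ∩ A) →
                   ∃[ A₁ ] ∃[ S₁ ] Separation r A₁ S₁ × weight A₀ F < weight A₁ S₁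
          absorb {r} {A₀} {F} r≤t sep A S A⊆ S⊆ ∂⊆S smallA meet few = A₁ , S₁ , record
              { A⊆U = λ v p → [ A⊆U v , A⊆ v ]′ (∨⁻ p)
              ; S⊆U = λ v p → [ S⊆U v ∘ ∧⁻ˡ , S⊆ v ∘ ∧⁻ˡ ∘ ∧⁻ˡ ]′ (∨⁻ p)
              ; boundary = boundary₁
              ; disjoint = disjoint₁
              ; small = join-small A⊆U A⊆ (≤-trans (#-mono boundary₁) (≤-trans order₁ r≤t)) small smallA
              ; order = order₁
              } , heavier
            where
            open Separation sep
            open ≤-Reasoning
            A₁ = A₀ ∪ A
            S₁ = (F ∖ A) ∪ ((S ∖ F) ∖ A₁)
            boundary₁ : ∂ G U A₁ ⊆ S₁
            boundary₁ v p with ∂-edge G p | split (F v)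
            ... | u , u∈ , uv | inj₁ q = ∨⁺ˡ (∧⁺ q (not⁺ (¬-not λ a → true≢false (∨⁺ʳ {A₀ v} a) (∂-out G p))))
            ... | u , u∈ , uv | inj₂ q with ∨⁻ {A₀ u} u∈
            ...   | inj₁ a = true≢false (boundary v (∂⁺ G u (∂⊆ G v p)
                      (¬-not λ a → true≢false (∨⁺ˡ a) (∂-out G p)) a uv)) q
            ...   | inj₂ a = ∨⁺ʳ {F v ∧ not (A v)} (∧⁺ (∧⁺ (∂⊆S v (∂⁺ G u (∂⊆ G v p)
                      (¬-not λ a → true≢false (∨⁺ʳ {A₀ v} a) (∂-out G p)) a uv)) (not⁺ q)) (not⁺ (∂-out G p)))
            disjoint₁ : ∀ v → v ∈ S₁ → v ∉ A₁
            disjoint₁ v p with ∨⁻ {F v ∧ not (A v)} p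
            ... | inj₁ q rewrite disjoint v (∧⁻ˡ q) = not⁻ (∧⁻ʳ {F v} q)
            ... | inj₂ q = not⁻ (∧⁻ʳ {S v ∧ not (F v)} q)
            order₁ : # S₁ ≤ r
            order₁ = begin
              # S₁                                   ≤⟨ #-cover (λ v → ∨⁻) ⟩
              # (F ∖ A) + # ((S ∖ F) ∖ A₁)           ≤⟨ +-monoʳ-≤ _ (≤-trans (#-mono (λ v → ∧⁻ˡ)) few) ⟩
              # (F ∖ A) + # (F ∩ A)                  ≡⟨ +-comm (# (F ∖ A)) _ ⟩
              # (F ∩ A) + # (F ∖ A)                  ≡⟨ #-split F A ⟨
              # F                                    ≤⟨ order ⟩
              r                                      ∎
            c = # (F ∩ A)
            lemma : ∀ a c f → 2 * a + (c + f) + c ≡ 2 * (a + c) + f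
            lemma = solve-∀
            heavier : weight A₀ F < weight A₁ S₁
            heavier = begin-strict
              2 * # A₀ + # F                         ≡⟨ cong (2 * # A₀ +_) (#-split F A) ⟩
              2 * # A₀ + (c + # (F ∖ A))             <⟨ m<m+n _ meet ⟩
              2 * # A₀ + (c + # (F ∖ A)) + c         ≡⟨ lemma (# A₀) c (# (F ∖ A)) ⟩
              2 * (# A₀ + c) + # (F ∖ A)             ≤⟨ +-mono-≤ (*-monoʳ-≤ 2 (#-pack (λ v → ∨⁺ˡ)
                                                          (λ v p → ∨⁺ʳ {A₀ v} (∧⁻ʳ {F v} p))
                                                          (λ v p → ¬-not λ q → true≢false p (disjoint v (∧⁻ˡ q)))))
                                                          (#-mono (λ v → ∨⁺ˡ)) ⟩
              2 * # A₁ + # S₁                        ∎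

          -- The separator of a small side of maximal weight is free. `m` bounds the distance of the
          -- weight from its upper bound `2 * # U + r`, so the search for a maximum ends.
          extremal : ∀ {r} → r ≤ t → ∀ m A S → Separation r A S → 2 * # U + r ≤ m + weight A S →
                     ¬ ¬ (∃[ F ] Free r F)
          improve : ∀ {r} → r ≤ t → ∀ m {A S} → 2 * # U + r ≤ m + weight A S →
                    ∀ A′ S′ → Separation r A′ S′ → weight A S < weight A′ S′ → ¬ ¬ (∃[ F ] Free r F)
          extremal {r} r≤t m A S sep fuel k with m≤n⇒m<n∨m≡n (Separation.order sep)
          ... | inj₁ S<r = let S′ , sep′ , lt = enlarge r≤t sep S<r in improve r≤t m fuel A S′ sep′ lt k
          ... | inj₂ eq  = k (S , Separation.S⊆U sep , eq , λ A′ S′ A⊆ S⊆ ∂⊆ small meet few →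
                let A₁ , S₁ , sep₁ , lt = absorb r≤t sep A′ S′ A⊆ S⊆ ∂⊆ small meet few in
                improve r≤t m fuel A₁ S₁ sep₁ lt k)
          improve r≤t zero    fuel A′ S′ sep lt k = <-irrefl refl (≤-trans lt (≤-trans (weight≤ sep) fuel))
          improve r≤t (suc m) fuel A′ S′ sep lt k =
            extremal r≤t m A′ S′ sep (≤-trans fuel (≤-trans (≤-reflexive (≡-sym (+-suc m _))) (+-monoʳ-≤ m lt))) k

        free-set : ∀ {r} → r ≤ t → ¬ ¬ (∃[ F ] Free r F)
        free-set {r} r≤t = extremal r≤t (2 * # U + r) none none record
          { A⊆U = λ _ () ; S⊆U = λ _ ()
          ; boundary = λ v p → let u , q , _ = ∂-edge G p in contradiction q λ ()
          ; disjoint = λ _ _ → refl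
          ; small = ≤-trans (≤-reflexive (#-empty λ v → ¬-not λ p → contradiction (∧⁻ʳ {W v} p) λ ())) z≤n
          ; order = ≤-trans (≤-reflexive (#-none n)) z≤n
          } (m≤m+n _ _)

        module _ {r F} (r≤t : r ≤ t) (k≤r : k ≤ r) (free : Free r F) where
          private
            F⊆U = proj₁ free
            #F  = proj₁ (proj₂ free)
            resists = proj₂ (proj₂ free)

            -- Freeness is used here with the boundary of `A` as separator.
            free-few : ∀ {A} → A ⊆ U → # (∂ G U A) ≤ k → # (W ∩ A) ≤ e → # (F ∩ A) ≤ k
            free-few {A} A⊆ ∂≤ small = ≮⇒≥ λ gt → resists A (∂ G U A) A⊆ (∂⊆ G) (λ _ p → p) small
              (≤-trans (s≤s z≤n) gt) (≤-trans (#-mono {B = ∂ G U A} (λ v → ∧⁻ˡ)) (≤-trans ∂≤ (<⇒≤ gt)))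

          free-anchored : Anchored k U F
          free-anchored A A⊆ ∂≤ with decides A A⊆ (≤-trans ∂≤ (≤-trans k≤r r≤t))
          ... | inj₁ small = inj₁ (free-few A⊆ ∂≤ small)
          ... | inj₂ big   = inj₂ (free-few far⊆ (≤-trans (#-mono ∂-far) ∂≤) (far-small {A} big))

          -- Suppose fewer than `r` vertices `C` separate `F` from `Z`. If the side of `F` is small
          -- for the tangle, freeness fails. Otherwise it contains most of `W`, yet `Z` supplies
          -- more than `# C` vertices of `W` on the other side, against well-linkedness.
          free-linked : ∀ {θ Z} → WellLinked θ W → r ≤ θ → r ≤ e → Z ⊆ W → # Z ≡ r → ¬ ¬ Linkage G F Z
          free-linked {θ} {Z} linked r≤θ r≤e Z⊆W #Z = menger G F Z λ A C closes F⊆ avoids → ≮⇒≥ λ C<F →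
            let C<r : # C < r
                C<r = ≤-trans C<F (≤-reflexive #F)
                ∂⊆C : ∂ G U (A ∩ U) ⊆ C
                ∂⊆C v p = let u , q , uv = ∂-edge G p in
                  closes u v (∧⁻ˡ q) uv (¬-not λ a → true≢false (∧⁺ a (∂⊆ G v p)) (∂-out G p))
                meet : # (C ∖ F) < # (F ∩ (A ∩ U))
                meet = +-cancelˡ-< (# (C ∩ F)) _ _ (begin-strict
                  # (C ∩ F) + # (C ∖ F)               ≡⟨ #-split C F ⟨
                  # C                                 <⟨ C<F ⟩
                  # F                                 ≤⟨ #-cover (λ v p → [ (λ a → inj₂ (∧⁺ p (∧⁺ a (F⊆U v p))))
                                                                          , (λ c → inj₁ (∧⁺ c p)) ]′ (∨⁻ (F⊆ v p))) ⟩
                  # (C ∩ F) + # (F ∩ (A ∩ U))         ∎)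
            in [ (λ small → resists (A ∩ U) (C ∩ U) (λ v → ∧⁻ʳ {A v}) (λ v → ∧⁻ʳ {C v})
                   (λ v p → ∧⁺ (∂⊆C v p) (∂⊆ G v p)) small (≤-trans (s≤s z≤n) meet)
                   (≤-trans (#-mono {B = C ∖ F} (λ v p → ∧⁺ (∧⁻ˡ {C v} (∧⁻ˡ p)) (∧⁻ʳ {C v ∧ U v} p))) (<⇒≤ meet)))
               , (λ big → [ (λ x → <-irrefl refl (begin-strict
                     # W                                    ≤⟨ #-cover {B = W ∖ (A ∩ U)} {W ∩ (A ∪ C)} (cover A C) ⟩
                     # (W ∖ (A ∩ U)) + # (W ∩ (A ∪ C))      ≤⟨ +-mono-≤ big (≤-trans x (<⇒≤ C<r)) ⟩
                     e + r                                  ≤⟨ +-monoʳ-≤ e r≤e ⟩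
                     e + e                                  ≤⟨ m≤m+n (e + e) e ⟩
                     e + e + e                              ≡⟨ e+e+e ⟩
                     3 * e                                  ≤⟨ m≤m+n _ t ⟩
                     3 * e + t                              <⟨ room ⟩
                     # W                                    ∎))
                          , (λ x → <-irrefl refl (begin-strict
                     # C                                    <⟨ C<r ⟩
                     r                                      ≡⟨ #Z ⟨
                     # Z                                    ≤⟨ #-mono (λ v p → ∧⁺ (Z⊆W v p)
                                                                 (not⁺ (¬-not λ a → true≢false p (avoids v a)))) ⟩
                     # (W ∖ A)                              ≤⟨ x ⟩
                     # C                                    ∎))
                          ]′ (linked A C closes (≤-trans (<⇒≤ C<r) r≤θ)))
               ]′ (decides (A ∩ U) (λ v → ∧⁻ʳ {A v}) (≤-trans (#-mono ∂⊆C) (≤-trans (<⇒≤ C<r) r≤t)))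
            where
            open ≤-Reasoning
            cover : ∀ A C v → v ∈ W → v ∈ W ∖ (A ∩ U) ⊎ v ∈ W ∩ (A ∪ C)
            cover A C v w with A v
            ... | true  = inj₂ (∧⁺ w refl)
            ... | false = inj₁ (∧⁺ w refl)

      -- Raising the order of a tangle

      module _ {θ} (linked : WellLinked θ W) {r} (r≡ : r ≡ 8 + 14 * k) (r≤e : r ≤ e) (r≤θ : r ≤ θ) where

        -- Otherwise the starts of r long walks, linked to a free set of U, would yield hairs either on U
        -- or on U enlarged by the short walks of the linkage.
        few-long-walks : ∀ {t U} → Tangle t U → r ≤ t → ∀ {X Y} (link : Linkage G X Y) → X ⊆ W →
                         ∀ ℓ → (1 + r) * suc (# U) ≤ suc ℓ →
                         # (X ∖ (λ x → Y (follow G link x ℓ))) < r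
        few-long-walks {t} {U} tangle r≤t {X} {Y} link X⊆W ℓ ℓ-big = ≰⇒> λ many →
          let long = X ∖ (λ x → Y (follow G link x ℓ))
              Z , _ , Z⊆ , #Z = #-between none long r (λ _ ()) (≤-trans (≤-reflexive (#-none n)) z≤n) many
          in free-set tangle r≤t λ (F , free) →
             free-linked tangle r≤t k≤r free linked r≤θ r≤e (λ v p → X⊆W v (∧⁻ˡ (Z⊆ v p))) #Z λ to-Z →
             hang Z Z⊆ F free to-Z
          where
          k≤r : k ≤ r
          k≤r = ≤-trans (m≤m*n k 14) (≤-trans (≤-reflexive (*-comm k 14))
                  (≤-trans (m≤n+m (14 * k) 8) (≤-reflexive (≡-sym r≡))))
          hang : ∀ Z → Z ⊆ X ∖ (λ x → Y (follow G link x ℓ)) → ∀ F → Free tangle r F → Linkage G F Z → ⊥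
          hang Z Z⊆ F free to-Z = <-irrefl refl (begin-strict
              4 + 2 * (k + k) + 4 * k     ≤⟨ short-many ⟩
              # S                         ≤⟨ S≤E ⟩
              # E                         <⟨ no-hairs {ε = k + k} {U₁} {E} {E} E-anchored E⊆U₁ (λ _ p → p)
                                               (restrict G (λ v p → ∧⁻ˡ (Z⊆ v (E⊆Z v p))) (follow-walks G link))
                                               (λ x p → follow-simple G link (∧⁻ˡ (Z⊆ x (E⊆Z x p)))
                                                 (not⁻ (∧⁻ʳ {X x} (Z⊆ x (E⊆Z x p))))) U₁≤ ⟩
              4 + 2 * (k + k) + 4 * k     ∎)
            where
            open ≤-Reasoning
            -- Walks to `Z` that are still under way after `# U` steps are long enough to be hairs
            -- on `U`.
            ℓ₀ = # U
            o = follow G to-Z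
            arrived S E U₁ : BSet n
            arrived x = Z (o x ℓ₀)
            S = F ∩ arrived
            -- The ends of the short walks, which are also starts of the given long walks; they
            -- serve as the anchored set in `U₁`.
            E = ⋃ S (λ x z → o x ℓ₀ == z)
            U₁ = U ∪ trace G S o ℓ₀
            walks : Walks G S o
            walks = restrict G (λ v → ∧⁻ˡ) (follow-walks G to-Z)
            S⊆F : S ⊆ F
            S⊆F v = ∧⁻ˡ
            -- This fixes `r = 8 + 14 * k`: it is the sum of the `no-hairs` bounds for `ε = k`,
            -- applied to the late walks from `F`, and for `ε = k + k`, applied to the hairs at `E`.
            short-many : 4 + 2 * (k + k) + 4 * k ≤ # S
            short-many = +-cancelʳ-≤ (4 + 2 * k + 4 * k) _ _ (begin
              4 + 2 * (k + k) + 4 * k + (4 + 2 * k + 4 * k)   ≡⟨ lemma k ⟩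
              8 + 14 * k                                      ≡⟨ r≡ ⟨
              r                                               ≡⟨ proj₁ (proj₂ free) ⟨
              # F                                             ≡⟨ #-split F arrived ⟩
              # S + # (F ∖ arrived)                           ≤⟨ +-monoʳ-≤ (# S) (<⇒≤ (no-hairs {ε = k} {U} {F}
                                                                   (free-anchored tangle r≤t k≤r free) (proj₁ free) (λ v → ∧⁻ˡ)
                                                                   (restrict G (λ v → ∧⁻ˡ) (follow-walks G to-Z))
                                                                   (λ x p → follow-simple G to-Z (∧⁻ˡ p) (not⁻ (∧⁻ʳ {F x} p)))
                                                                   (n≤1+n (# U)))) ⟩
              # S + (4 + 2 * k + 4 * k)                       ∎)
              where
              lemma : ∀ k → 4 + 2 * (k + k) + 4 * k + (4 + 2 * k + 4 * k) ≡ 8 + 14 * k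
              lemma = solve-∀
            S≤E : # S ≤ # E
            S≤E = #-inj (λ x _ → o x ℓ₀) (λ x p → ⋃⁺ x p (==⁺ refl))
                    (λ x y p q eq → Walks.disjoint walks x y ℓ₀ ℓ₀ p q eq)
            origin : ∀ z → z ∈ E → ∃[ x ] x ∈ S × o x ℓ₀ ≡ z
            origin z p with ⋃⁻ {P = S} {λ x z → o x ℓ₀ == z} p
            ... | x , q , r = x , q , ==⁻ r
            E⊆Z : E ⊆ Z
            E⊆Z z p with origin z p
            ... | x , q , refl = ∧⁻ʳ {F x} q
            E⊆U₁ : E ⊆ U₁
            E⊆U₁ z p with origin z p
            ... | x , q , refl = ∨⁺ʳ {U z} (trace⁺ G q ≤-refl)
            U₁≤ : # U₁ ≤ suc ℓ
            U₁≤ = begin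
              # U₁                               ≤⟨ #-cover (λ v → ∨⁻) ⟩
              # U + # (trace G S o ℓ₀)           ≤⟨ +-mono-≤ (n≤1+n _) (#-trace-≤ G S o ℓ₀) ⟩
              suc (# U) + # S * suc (# U)        ≤⟨ +-monoʳ-≤ (suc (# U)) (*-monoˡ-≤ (suc (# U))
                                                      (≤-trans (#-mono S⊆F) (≤-reflexive (proj₁ (proj₂ free))))) ⟩
              (1 + r) * suc (# U)                ≤⟨ ℓ-big ⟩
              suc ℓ                              ∎
            -- An end in `B` belongs to a walk that starts in `B` or crosses the boundary of `B`;
            -- each kind accounts for at most `k`.
            transfer : ∀ B → # (∂ G U₁ B) ≤ k → # (F ∩ B) ≤ k → # (E ∩ B) ≤ k + k
            transfer B ∂≤ few = begin
              # (E ∩ B)                          ≤⟨ #-inj {Q = S ∩ (λ x → B (o x ℓ₀))} (λ z p → proj₁ (origin z (∧⁻ˡ p)))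
                                                      (λ z p → let x , q , e = origin z (∧⁻ˡ p) in
                                                        ∧⁺ q (trans (cong B e) (∧⁻ʳ {E z} p)))
                                                      (λ z z′ p p′ eq → trans (≡-sym (proj₂ (proj₂ (origin z (∧⁻ˡ p)))))
                                                        (trans (cong (λ x → o x ℓ₀) eq) (proj₂ (proj₂ (origin z′ (∧⁻ˡ p′)))))) ⟩
              # (S ∩ (λ x → B (o x ℓ₀)))         ≤⟨ #-cover {B = F ∩ B} {D} cover ⟩
              # (F ∩ B) + # D                    ≤⟨ +-mono-≤ few (≤-trans (#-crossing G walks B (λ x → ∧⁻ˡ ∘ ∧⁻ˡ {S x ∧ B (o x ℓ₀)})
                                                      (λ x i p i≤ → ∨⁺ʳ {U (o x i)} (trace⁺ G (∧⁻ˡ (∧⁻ˡ {S x ∧ B (o x ℓ₀)} p)) i≤))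
                                                      (λ x p → ℓ₀ , ≤-refl , λ e → true≢false (∧⁻ʳ {S x} (∧⁻ˡ p))
                                                        (trans (≡-sym e) (not⁻ (∧⁻ʳ {S x ∧ B (o x ℓ₀)} p))))) ∂≤) ⟩
              k + k                              ∎
              where
              D : BSet n
              D = (S ∩ (λ x → B (o x ℓ₀))) ∖ B
              cover : ∀ x → x ∈ S ∩ (λ x → B (o x ℓ₀)) → x ∈ F ∩ B ⊎ x ∈ D
              cover x p with split (B x)
              ... | inj₁ q = inj₁ (∧⁺ (S⊆F x (∧⁻ˡ p)) q)
              ... | inj₂ q = inj₂ (∧⁺ p (not⁺ q))
            U⊆U₁ : U ⊆ U₁
            U⊆U₁ v = ∨⁺ˡ
            E-anchored : Anchored (k + k) U₁ E
            E-anchored A A⊆ ∂≤ with free-anchored tangle r≤t k≤r free (A ∩ U) (λ v → ∧⁻ʳ {A v})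
                                      (≤-trans (#-mono (∂-restrict {U} {U₁} {A} U⊆U₁)) ∂≤)
            ... | inj₁ few = inj₁ (transfer A ∂≤ (≤-trans (#-mono (λ v p →
                    ∧⁺ (∧⁻ˡ {F v} p) (∧⁺ (∧⁻ʳ {F v} p) (proj₁ free v (∧⁻ˡ {F v} p))))) few))
            ... | inj₂ few = inj₂ (transfer (far U₁ A) (≤-trans (#-mono ∂-far) ∂≤) (≤-trans (#-mono inside) few))
              where
              inside : F ∩ far U₁ A ⊆ F ∩ far U (A ∩ U)
              inside v p = ∧⁺ (∧⁻ˡ p) (far⁺ (proj₁ free v (∧⁻ˡ p))
                (¬-not λ q → true≢false (∧⁻ˡ q) (far-out (∧⁻ʳ {F v} p)))
                (¬-not λ q → true≢false (∂-restrict {U} {U₁} {A} U⊆U₁ v q) (far-out∂ (∧⁻ʳ {F v} p))))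

        boost : ∀ {h} → # W ≡ 2 ^ h → # W ≤ θ → ∀ {t U} → Tangle t U → r ≤ t →
                ∀ t′ → 3 * e + t′ < # W → 2 * ((r + t′) * (r + t′)) ≤ e →
                ¬ ¬ (∃[ U′ ] Tangle t′ U′ × # U′ ≤ # W + # W * (# W * ((1 + r) * suc (# U))))
        boost {h} #W W≤θ {t} {U} tangle r≤t t′ room D≤e done = ¬¬-choice h link assemble
          where
          open Characters (characters h W #W)
          open ≤-Reasoning
          -- If `C` is too small, both sides contain more than `# C` vertices of `W`: one contains
          -- `W ∩ χ c`, the other `W ∖ χ c`, which has the same size.
          link : ∀ c → ¬ ¬ Linkage G (W ∩ χ c) (W ∖ χ c)
          link c = menger G (W ∩ χ c) (W ∖ χ c) λ A C closes X⊆ avoids → ≮⇒≥ λ C<X →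
            [ (λ p → <-irrefl refl (begin-strict
                # C                      <⟨ C<X ⟩
                # (W ∩ χ c)              ≤⟨ #-mono (λ v q → ∧⁺ (∧⁻ˡ q) (X⊆ v q)) ⟩
                # (W ∩ (A ∪ C))          ≤⟨ p ⟩
                # C                      ∎))
            , (λ p → <-irrefl refl (begin-strict
                # C                      <⟨ C<X ⟩
                # (W ∩ χ c)              ≡⟨ balanced c ⟩
                # (W ∖ χ c)              ≤⟨ #-mono (λ v q → ∧⁺ (∧⁻ˡ {W v} q) (not⁺ (¬-not λ a → true≢false q (avoids v a)))) ⟩
                # (W ∖ A)                ≤⟨ p ⟩
                # C                      ∎))
            ]′ (linked A C closes (≤-trans (<⇒≤ C<X) (≤-trans (#-mono (λ v → ∧⁻ˡ)) W≤θ)))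
          L = (1 + r) * suc (# U)
          -- `suc ℓ` is `L`, the least length that `few-long-walks` accepts.
          ℓ = # U + r * suc (# U)
          assemble : (∀ c → Linkage G (W ∩ χ c) (W ∖ χ c)) → ⊥
          assemble links = done (U′ , record { room = room ; large = large ; decides = decides } , U′≤)
            where
            o : Character h → Fin n → ℕ → Fin n
            o c = follow G (links c)
            arrived S T : Character h → BSet n
            arrived c x = (W ∖ χ c) (o c x ℓ)
            S c = (W ∩ χ c) ∩ arrived c
            T c = trace G (S c) (o c) ℓ
            walks : ∀ c → Walks G (S c) (o c)
            walks c = restrict G (λ v → ∧⁻ˡ) (follow-walks G (links c))
            U′ : BSet n
            U′ = W ∪ ⋃ᶜ h T
            U′≤ : # U′ ≤ # W + # W * (# W * L)
            U′≤ = begin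
              # U′                                       ≤⟨ #-cover (λ v → ∨⁻) ⟩
              # W + # (⋃ᶜ h T)                           ≤⟨ +-monoʳ-≤ (# W) (#-⋃ᶜ h T) ⟩
              # W + sumᶜ h (λ c → # (T c))               ≤⟨ +-monoʳ-≤ (# W) (sumᶜ-mono h λ c → ≤-trans (#-trace-≤ G (S c) (o c) ℓ)
                                                              (*-monoˡ-≤ L (#-mono (λ v → ∧⁻ˡ ∘ ∧⁻ˡ {W v ∧ χ c v})))) ⟩
              # W + sumᶜ h (λ _ → # W * L)               ≤⟨ +-monoʳ-≤ (# W) (m≤m+n _ (# W * L)) ⟩
              # W + (sumᶜ h (λ _ → # W * L) + # W * L)   ≡⟨ cong (# W +_) (sumᶜ-const h (# W * L)) ⟩
              # W + 2 ^ h * (# W * L)                    ≡⟨ cong (λ w → # W + w * (# W * L)) #W ⟨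
              # W + # W * (# W * L)                      ∎
            large : # (W ∖ U′) ≤ e
            large = ≤-trans (≤-reflexive (#-empty λ v → ¬-not λ p →
              true≢false (∨⁺ˡ {W v} (∧⁻ˡ {W v} p)) (not⁻ (∧⁻ʳ {W v} p)))) z≤n
            decides : ∀ A → A ⊆ U′ → # (∂ G U′ A) ≤ t′ → # (W ∩ A) ≤ e ⊎ # (W ∖ A) ≤ e
            decides A A⊆ ∂≤ = [ (λ p → inj₁ (≤-trans p D≤e)) , (λ p → inj₂ (≤-trans p D≤e)) ]′
              (discrepancy (characters h W #W) #W A (r + t′) (λ c → forth c , back c))
              where
              module _ (c : Character h) where
                X = W ∩ χ c
                Y = W ∖ χ c
                ends long into : BSet n
                ends x = A (o c x ℓ)
                long = X ∖ arrived c
                into = S c ∩ ends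
                few : # long ≤ r
                few = <⇒≤ (few-long-walks tangle r≤t (links c) (λ v → ∧⁻ˡ) ℓ ≤-refl)
                crossing≤ : ∀ {D} → D ⊆ S c → (∀ x → x ∈ D → A x ≢ A (o c x ℓ)) → # D ≤ t′
                crossing≤ D⊆ crosses = ≤-trans (#-crossing G (walks c) A D⊆
                  (λ x i p i≤ → ∨⁺ʳ {W (o c x i)} (⋃ᶜ⁺ h {S = T} c (o c x i) (trace⁺ G (D⊆ x p) i≤)))
                  (λ x p → ℓ , ≤-refl , crosses x p)) ∂≤
                end-inj : ∀ x y → x ∈ S c → y ∈ S c → o c x ℓ ≡ o c y ℓ → x ≡ y
                end-inj x y p q = Walks.disjoint (walks c) x y ℓ ℓ p q
                -- A start in `X ∩ A` is late, or ends in `Y ∩ A`, or has a walk crossing the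
                -- boundary of `A`.
                forth : # (X ∩ A) ≤ # (Y ∩ A) + (r + t′)
                forth = begin
                  # (X ∩ A)                                    ≤⟨ #-cover {B = long} {S c ∩ A} cover ⟩
                  # long + # (S c ∩ A)                         ≤⟨ +-mono-≤ few (#-cover {B = into} {(S c ∩ A) ∖ ends} cover′) ⟩
                  r + (# into + # ((S c ∩ A) ∖ ends))          ≤⟨ +-monoʳ-≤ r (+-mono-≤
                                                                    (#-inj {Q = Y ∩ A} (λ x _ → o c x ℓ)
                                                                      (λ x p → ∧⁺ (∧⁻ʳ {X x} (∧⁻ˡ p)) (∧⁻ʳ {S c x} p))
                                                                      (λ x y p q → end-inj x y (∧⁻ˡ p) (∧⁻ˡ q)))
                                                                    (crossing≤ (λ x → ∧⁻ˡ ∘ ∧⁻ˡ {S c x ∧ A x}) λ x p e →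
                                                                      true≢false (∧⁻ʳ {S c x} (∧⁻ˡ p))
                                                                        (trans e (not⁻ (∧⁻ʳ {S c x ∧ A x} p))))) ⟩
                  r + (# (Y ∩ A) + t′)                         ≡⟨ lemma r (# (Y ∩ A)) t′ ⟩
                  # (Y ∩ A) + (r + t′)                         ∎
                  where
                  lemma : ∀ r y t → r + (y + t) ≡ y + (r + t)
                  lemma = solve-∀
                  cover : ∀ x → x ∈ X ∩ A → x ∈ long ⊎ x ∈ S c ∩ A
                  cover x p with split (arrived c x)
                  ... | inj₁ q = inj₂ (∧⁺ (∧⁺ (∧⁻ˡ {X x} p) q) (∧⁻ʳ {X x} p))
                  ... | inj₂ q = inj₁ (∧⁺ (∧⁻ˡ p) (not⁺ q))
                  cover′ : ∀ x → x ∈ S c ∩ A → x ∈ into ⊎ x ∈ (S c ∩ A) ∖ ends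
                  cover′ x p with split (ends x)
                  ... | inj₁ q = inj₁ (∧⁺ (∧⁻ˡ p) q)
                  ... | inj₂ q = inj₂ (∧⁺ p (not⁺ q))
                -- Not every vertex of `Y` need be an end, so the complement is counted instead:
                -- walks ending outside `A` inject into `Y ∖ A`, and `X` and `Y` have equal size.
                back : # (Y ∩ A) ≤ # (X ∩ A) + (r + t′)
                back = +-cancelʳ-≤ (# (Y ∖ A)) _ _ (begin
                  # (Y ∩ A) + # (Y ∖ A)                        ≡⟨ #-split Y A ⟨
                  # Y                                          ≡⟨ balanced c ⟨
                  # X                                          ≡⟨ #-split X (arrived c) ⟩
                  # (S c) + # long                             ≡⟨ cong (_+ # long) (#-split (S c) ends) ⟩
                  # into + # (S c ∖ ends) + # long             ≤⟨ +-mono-≤ (+-mono-≤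
                                                                    (#-cover {B = X ∩ A} {into ∖ A} cover)
                                                                    (#-inj {Q = Y ∖ A} (λ x _ → o c x ℓ)
                                                                      (λ x p → ∧⁺ (∧⁻ʳ {X x} (∧⁻ˡ p)) (∧⁻ʳ {S c x} p))
                                                                      (λ x y p q → end-inj x y (∧⁻ˡ p) (∧⁻ˡ q)))) few ⟩
                  # (X ∩ A) + # (into ∖ A) + # (Y ∖ A) + r     ≤⟨ +-monoˡ-≤ r (+-monoˡ-≤ (# (Y ∖ A)) (+-monoʳ-≤ (# (X ∩ A))
                                                                    (crossing≤ (λ x → ∧⁻ˡ ∘ ∧⁻ˡ {S c x ∧ ends x}) λ x p e →
                                                                      true≢false (∧⁻ʳ {S c x} (∧⁻ˡ p))
                                                                        (trans (≡-sym e) (not⁻ (∧⁻ʳ {S c x ∧ ends x} p)))))) ⟩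
                  # (X ∩ A) + t′ + # (Y ∖ A) + r               ≡⟨ lemma (# (X ∩ A)) t′ (# (Y ∖ A)) r ⟩
                  # (X ∩ A) + (r + t′) + # (Y ∖ A)             ∎)
                  where
                  lemma : ∀ x t y r → x + t + y + r ≡ x + (r + t) + y
                  lemma = solve-∀
                  cover : ∀ x → x ∈ into → x ∈ X ∩ A ⊎ x ∈ into ∖ A
                  cover x p with split (A x)
                  ... | inj₁ q = inj₁ (∧⁺ (∧⁻ˡ {X x} (∧⁻ˡ {S c x} p)) q)
                  ... | inj₂ q = inj₂ (∧⁺ p (not⁺ q))

      -- Halving a tangle

      tangle-size : ∀ {t U} → Tangle t U → 2 * e + t < # U
      tangle-size {t} {U} tangle = +-cancelˡ-< e _ _ (begin-strict
        e + (2 * e + t)              ≡⟨ lemma e t ⟩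
        3 * e + t                    <⟨ room ⟩
        # W                          ≡⟨ #-split W U ⟩
        # (W ∩ U) + # (W ∖ U)        ≤⟨ +-mono-≤ (#-mono (λ v → ∧⁻ʳ {W v})) large ⟩
        # U + e                      ≡⟨ +-comm (# U) e ⟩
        e + # U                      ∎)
        where
        open Tangle tangle
        open ≤-Reasoning
        lemma : ∀ e t → e + (2 * e + t) ≡ 3 * e + t
        lemma = solve-∀

      -- A separation of `U′` becomes one of `U` once the boundary of `U′` joins its separator; this
      -- is the cost `k` of a sweep.
      sub-tangle : ∀ {t U U′} → Tangle (k + t) U → U′ ⊆ U → # (∂ G U U′) ≤ k → # (W ∖ U′) ≤ e → Tangle t U′
      sub-tangle {t} {U} {U′} tangle sub ∂≤ large′ = record
        { room    = ≤-trans (s≤s (+-monoʳ-≤ (3 * e) (m≤n+m t k))) room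
        ; large   = large′
        ; decides = λ A A⊆ ∂A≤ → decides A (λ v → sub v ∘ A⊆ v)
            (≤-trans (#-cover (∂-sub A⊆)) (≤-trans (+-mono-≤ ∂A≤ ∂≤) (≤-reflexive (+-comm t k))))
        }
        where open Tangle tangle

      -- The side kept is the one with most of `W`. The term `2 * k` allows for the overshoot of the
      -- sweep if that is `A`, and 1 for rounding if it is the far side.
      shrink : ∀ {t U} → 1 ≤ e → Tangle (k + t) U → ∃[ U′ ] Tangle t U′ × 2 * # U′ ≤ # U + (2 * k + 1)
      shrink {t} {U} 1≤e tangle with sweep U ⌊ # U /2⌋ (⌊n/2⌋-mono U≥2) (⌊n/2⌋≤n (# U))
        where
        U≥2 : 2 ≤ # U
        U≥2 = ≤-trans (*-monoʳ-≤ 2 1≤e) (≤-trans (m≤m+n (2 * e) (k + t)) (<⇒≤ (tangle-size tangle)))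
      ... | A , A⊆ , A≥ , A≤ , ∂≤ with Tangle.decides tangle A A⊆ (≤-trans ∂≤ (m≤m+n k t))
      ...   | inj₂ big = A , sub-tangle tangle A⊆ ∂≤ big , (begin
          2 * # A                                     ≤⟨ *-monoʳ-≤ 2 A≤ ⟩
          2 * (⌊ # U /2⌋ + k)                         ≡⟨ lemma ⌊ # U /2⌋ k ⟩
          ⌊ # U /2⌋ + ⌊ # U /2⌋ + 2 * k               ≤⟨ +-mono-≤ (+-monoʳ-≤ ⌊ # U /2⌋ (⌊n/2⌋≤⌈n/2⌉ (# U))) (m≤m+n (2 * k) 1) ⟩
          ⌊ # U /2⌋ + ⌈ # U /2⌉ + (2 * k + 1)         ≡⟨ cong (_+ (2 * k + 1)) (⌊n/2⌋+⌈n/2⌉≡n (# U)) ⟩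
          # U + (2 * k + 1)                           ∎)
        where
        open ≤-Reasoning
        lemma : ∀ x k → 2 * (x + k) ≡ x + x + 2 * k
        lemma = solve-∀
      ...   | inj₁ small = far U A , sub-tangle tangle far⊆ (≤-trans (#-mono ∂-far) ∂≤)
                (far-large tangle A⊆ (≤-trans ∂≤ (m≤m+n k t)) small) , (begin
          2 * # (far U A)                             ≤⟨ *-monoʳ-≤ 2 far≤ ⟩
          2 * ⌈ # U /2⌉                               ≡⟨ cong (⌈ # U /2⌉ +_) (+-identityʳ _) ⟩
          ⌈ # U /2⌉ + ⌈ # U /2⌉                       ≤⟨ +-monoˡ-≤ ⌈ # U /2⌉ (⌊n/2⌋-mono (n≤1+n (suc (# U)))) ⟩
          suc ⌊ # U /2⌋ + ⌈ # U /2⌉                   ≡⟨ cong suc (⌊n/2⌋+⌈n/2⌉≡n (# U)) ⟩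
          suc (# U)                                   ≡⟨ +-comm 1 (# U) ⟩
          # U + 1                                     ≤⟨ +-monoʳ-≤ (# U) (m≤n+m 1 (2 * k)) ⟩
          # U + (2 * k + 1)                           ∎)
        where
        open ≤-Reasoning
        far≤ : # (far U A) ≤ ⌈ # U /2⌉
        far≤ = +-cancelˡ-≤ ⌊ # U /2⌋ _ _ (begin
          ⌊ # U /2⌋ + # (far U A)                     ≤⟨ +-monoˡ-≤ _ A≥ ⟩
          # A + # (far U A)                           ≤⟨ #-far A⊆ ⟩
          # U                                         ≡⟨ ⌊n/2⌋+⌈n/2⌉≡n (# U) ⟨
          ⌊ # U /2⌋ + ⌈ # U /2⌉                       ∎)

      -- `2 * k + 1` is the fixed point of the recursion in `shrink`, so the excess of the size over
      -- it is halved each time; the statement moves the negative terms across.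
      shrink* : ∀ j {t U} → 1 ≤ e → Tangle (j * k + t) U →
                ∃[ U′ ] Tangle t U′ × 2 ^ j * # U′ + (2 * k + 1) ≤ # U + 2 ^ j * (2 * k + 1)
      shrink* zero    {t} {U} 1≤e tangle = U , tangle , ≤-reflexive (lemma (# U) (2 * k + 1))
        where
        lemma : ∀ u K → 1 * u + K ≡ u + 1 * K
        lemma = solve-∀
      shrink* (suc j) {t} {U} 1≤e tangle with shrink 1≤e (subst (λ x → Tangle x U) (+-assoc k (j * k) t) tangle)
      ... | U₁ , tangle₁ , le₁ with shrink* j 1≤e tangle₁
      ...   | U₂ , tangle₂ , le₂ = U₂ , tangle₂ , +-cancelʳ-≤ K _ _ (begin
          2 ^ suc j * # U₂ + K + K                    ≡⟨ lemma (2 ^ j) (# U₂) K ⟩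
          2 * (2 ^ j * # U₂ + K)                      ≤⟨ *-monoʳ-≤ 2 le₂ ⟩
          2 * (# U₁ + 2 ^ j * K)                      ≡⟨ *-distribˡ-+ 2 (# U₁) (2 ^ j * K) ⟩
          2 * # U₁ + 2 * (2 ^ j * K)                  ≤⟨ +-monoˡ-≤ _ le₁ ⟩
          # U + K + 2 * (2 ^ j * K)                   ≡⟨ lemma′ (# U) K (2 ^ j) ⟩
          # U + 2 ^ suc j * K + K                     ∎)
        where
        open ≤-Reasoning
        K = 2 * k + 1
        lemma : ∀ p u K → 2 * p * u + K + K ≡ 2 * (p * u + K)
        lemma = solve-∀
        lemma′ : ∀ u K p → u + K + 2 * (p * K) ≡ u + 2 * p * K + K
        lemma′ = solve-∀

      -- Boosting the order of a tangle to r + j k and sweeping j times loses the extra order again,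
      -- but shrinks the tangle by more than boosting enlarged it.
      descent : ∀ {θ r h j} → WellLinked θ W → r ≡ 8 + 14 * k → # W ≡ 2 ^ h → # W ≤ θ →
                3 * e + (j * k + r) < # W → 2 * ((r + (j * k + r)) * (r + (j * k + r))) ≤ e → r ≤ e → r ≤ θ →
                # W * # W * (8 + 4 * r) < 2 ^ j → ∀ m U → # U ≤ m → ¬ Tangle r U
      descent {θ} {r} {h} {j} linked r≡ #W W≤θ room D≤e r≤e r≤θ j-big = go
        where
        open ≤-Reasoning
        w = # W
        1≤r : 1 ≤ r
        1≤r = ≤-trans (s≤s z≤n) (≤-reflexive (≡-sym r≡))
        1≤w : 1 ≤ w
        1≤w = ≤-trans (s≤s z≤n) room
        K≤e : 2 * k + 1 ≤ e
        K≤e = begin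
          2 * k + 1                     ≤⟨ m≤m+n (2 * k + 1) (7 + 12 * k) ⟩
          2 * k + 1 + (7 + 12 * k)      ≡⟨ lemma k ⟩
          8 + 14 * k                    ≡⟨ r≡ ⟨
          r                             ≤⟨ r≤e ⟩
          e                             ∎
          where
          lemma : ∀ k → 2 * k + 1 + (7 + 12 * k) ≡ 8 + 14 * k
          lemma = solve-∀
        -- All sizes are doubled, so that the additive loss `2 ^ j * (2 * (2 * k + 1))` fits into
        -- `2 ^ j * u`. The other half must absorb twice the size after boosting, at most
        -- `w * w * (8 + 4 * r) * u`.
        smaller : ∀ {u u₁ u₂} → 2 * e + r < u → u₁ ≤ w + w * (w * ((1 + r) * suc u)) →
                  2 ^ j * u₂ + (2 * k + 1) ≤ u₁ + 2 ^ j * (2 * k + 1) → u₂ < u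
        smaller {u} {u₁} {u₂} big le₁ le₂ = ≰⇒> λ u≤u₂ → <-irrefl refl (begin-strict
          2 * (2 ^ j * u)                                   ≤⟨ *-monoʳ-≤ 2 (*-monoʳ-≤ (2 ^ j) u≤u₂) ⟩
          2 * (2 ^ j * u₂)                                  ≤⟨ *-monoʳ-≤ 2 (≤-trans (m≤m+n (2 ^ j * u₂) (2 * k + 1)) le₂) ⟩
          2 * (u₁ + 2 ^ j * (2 * k + 1))                    ≡⟨ lemma₁ u₁ (2 ^ j) (2 * k + 1) ⟩
          2 * u₁ + 2 ^ j * (2 * (2 * k + 1))                ≤⟨ +-mono-≤ (*-monoʳ-≤ 2 le₁) (*-monoʳ-≤ (2 ^ j)
                                                                 (≤-trans (*-monoʳ-≤ 2 K≤e) (≤-trans (m≤m+n (2 * e) r) (<⇒≤ big)))) ⟩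
          2 * (w + w * (w * ((1 + r) * suc u))) + 2 ^ j * u ≤⟨ +-monoˡ-≤ (2 ^ j * u) (*-monoʳ-≤ 2 (+-mono-≤ w≤ (*-monoʳ-≤ w (*-monoʳ-≤ w
                                                                 (*-monoʳ-≤ (1 + r) (+-monoˡ-≤ u 1≤u)))))) ⟩
          2 * (w * (w * (2 * u)) + w * (w * ((1 + r) * (u + u)))) + 2 ^ j * u
                                                            ≡⟨ lemma₂ w u r (2 ^ j) ⟩
          w * w * (8 + 4 * r) * u + 2 ^ j * u               <⟨ +-monoˡ-< (2 ^ j * u) (*-monoˡ-< u {{>-nonZero 1≤u}} j-big) ⟩
          2 ^ j * u + 2 ^ j * u                             ≡⟨ lemma₃ (2 ^ j * u) ⟩
          2 * (2 ^ j * u)                                   ∎)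
          where
          1≤u : 1 ≤ u
          1≤u = ≤-trans (s≤s z≤n) big
          w≤ : w ≤ w * (w * (2 * u))
          w≤ = begin
            w                    ≡⟨ *-identityʳ w ⟨
            w * 1                ≤⟨ *-monoʳ-≤ w (*-mono-≤ 1≤w (≤-trans 1≤u (m≤m+n u (1 * u)))) ⟩
            w * (w * (2 * u))    ∎
          lemma₁ : ∀ u p K → 2 * (u + p * K) ≡ 2 * u + p * (2 * K)
          lemma₁ = solve-∀
          lemma₂ : ∀ w u r p → 2 * (w * (w * (2 * u)) + w * (w * ((1 + r) * (u + u)))) + p * u
                             ≡ w * w * (8 + 4 * r) * u + p * u
          lemma₂ = solve-∀
          lemma₃ : ∀ x → x + x ≡ 2 * x
          lemma₃ = solve-∀
        go : ∀ m U → # U ≤ m → ¬ Tangle r U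
        go zero    U U≤ tangle = contradiction (≤-trans (tangle-size tangle) U≤) λ ()
        go (suc m) U U≤ tangle =
          boost linked r≡ r≤e r≤θ {h} #W W≤θ tangle ≤-refl (j * k + r) room D≤e λ (U₁ , tangle₁ , le₁) →
            let U₂ , tangle₂ , le₂ = shrink* j (≤-trans 1≤r r≤e) tangle₁
            in go m U₂ (s≤s⁻¹ (≤-trans (smaller (tangle-size tangle) le₁ le₂) U≤)) tangle₂

      -- In the whole graph the boundary of `A` is a separator, so well-linkedness itself decides.
      full-tangle : ∀ {θ t} → WellLinked θ W → t ≤ θ → t ≤ e → 3 * e + t < # W → Tangle t full
      full-tangle {θ} {t} linked t≤θ t≤e room = record
        { room    = room
        ; large   = ≤-trans (≤-reflexive (#-empty λ v → ¬-not λ p → contradiction (∧⁻ʳ {W v} p) λ ())) z≤n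
        ; decides = λ A _ ∂≤ →
            [ (λ p → inj₁ (≤-trans (#-mono (λ v q → ∧⁺ (∧⁻ˡ {W v} q) (∨⁺ˡ (∧⁻ʳ {W v} q)))) (≤-trans p (≤-trans ∂≤ t≤e))))
            , (λ p → inj₂ (≤-trans p (≤-trans ∂≤ t≤e)))
            ]′ (linked A (∂ G full A) (λ u v p uv q → ∂⁺ G u refl q p uv) (≤-trans ∂≤ t≤θ))
        }

-- The cop game

opaque
  unfolding #_

  ∣∣≡# : ∀ {n} (p : Subset n) → ∣ p ∣ ≡ # (lookup p)
  ∣∣≡# []          = refl
  ∣∣≡# (true  ∷ p) = cong suc (∣∣≡# p)
  ∣∣≡# (false ∷ p) = ∣∣≡# p

∉ˢ⁺ : ∀ {n} {p : Subset n} {v} → lookup p v ≡ false → v ∉ˢ p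
∉ˢ⁺ q r = true≢false ([]=⇒lookup r) q

module _ {n} (G : Graph n) {k : ℕ} where

  private
    Sweep : BSet n → ℕ → Set
    Sweep U τ = ∃[ A ] A ⊆ U × τ ≤ # A × # A ≤ τ + k × # (∂ G U A) ≤ k

    -- B underestimates the robber's territory within U; the run stops when B first drops below τ.
    track : ∀ {U τ} → 1 ≤ τ → ∀ (C : Subset n) (R : Fin n → Set) Cs (B : BSet n) → B ⊆ U →
            (∀ v → v ∈ B → R v) → (∀ v → v ∈ B → v ∉ lookup C) → τ ≤ # B →
            foldr _⊔_ 0 (map ∣_∣ Cs) ≤ k → (∀ v → ¬ finalA-go G 1 C R Cs v) → Sweep U τ
    track τ≥1 C R []ˡ B B⊆ B⊆R B∩C τ≤ cops wins =
      let v , v∈ = #-inhabited (≤-trans τ≥1 τ≤) in contradiction (B⊆R v v∈) (wins v)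
    track {U} {τ} τ≥1 C R (C′ ∷ˡ Cs) B B⊆ B⊆R B∩C τ≤ cops wins with τ ≤? # ((B ∪ ∂ G U B) ∖ lookup C′)
    ... | yes τ≤′ = track τ≥1 C′ _ Cs ((B ∪ ∂ G U B) ∖ lookup C′)
            (λ v p → [ B⊆ v , ∂⊆ G v ]′ (∨⁻ (∧⁻ˡ p))) reach (λ v p → not⁻ (∧⁻ʳ {B v ∨ ∂ G U B v} p))
            τ≤′ (m⊔n≤o⇒n≤o ∣ C′ ∣ _ cops) wins
      where
      -- `B` avoids the old cops and the new vertex avoids the new ones, so neither end of the move
      -- lies in `C ∩ C′`.
      reach : ∀ v → v ∈ (B ∪ ∂ G U B) ∖ lookup C′ → nextA G 1 C R C′ v
      reach v p with ∨⁻ {B v} (∧⁻ˡ p)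
      ... | inj₁ b = ∉ˢ⁺ (not⁻ (∧⁻ʳ {B v ∨ ∂ G U B v} p)) , v , B⊆R v b , 0 , z≤n ,
              here (∉ˢ⁺ (B∩C v b) ∘ proj₁ ∘ x∈p∩q⁻ C C′) , [] ∷ []
      ... | inj₂ d with ∂-edge G d
      ...   | u , u∈ , uv = ∉ˢ⁺ v∉C′ , u , B⊆R u u∈ , 1 , s≤s z≤n ,
              step (∉ˢ⁺ (B∩C u u∈) ∘ proj₁ ∘ x∈p∩q⁻ C C′) uv (here (∉ˢ⁺ v∉C′ ∘ proj₂ ∘ x∈p∩q⁻ C C′)) ,
              ((λ { refl → true≢false u∈ (∂-out G d) }) ∷ []) ∷ [] ∷ []
        where v∉C′ = not⁻ (∧⁻ʳ {B v ∨ ∂ G U B v} p)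
    -- The sum of `# B` and its boundary is below `τ + k`. As `# B` is at least `τ`, this bounds
    -- both the size and the boundary.
    ... | no τ≰ = B , B⊆ , τ≤ , ≤-trans (m≤m+n _ _) (≤-trans grown (+-monoˡ-≤ k (<⇒≤ (≰⇒> τ≰)))) ,
            +-cancelˡ-≤ τ _ _ (≤-trans (+-monoˡ-≤ _ τ≤) (≤-trans grown (+-monoˡ-≤ k (<⇒≤ (≰⇒> τ≰)))))
      where
      open ≤-Reasoning
      N = B ∪ ∂ G U B
      grown : # B + # (∂ G U B) ≤ # (N ∖ lookup C′) + k
      grown = begin
        # B + # (∂ G U B)                          ≤⟨ #-pack (λ v → ∨⁺ˡ) (λ v → ∨⁺ʳ {B v})
                                                        (λ v p → ¬-not λ q → true≢false p (∂-out G q)) ⟩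
        # N                                        ≡⟨ #-split N (lookup C′) ⟩
        # (N ∩ lookup C′) + # (N ∖ lookup C′)      ≤⟨ +-monoˡ-≤ _ (#-mono (λ v → ∧⁻ʳ {N v})) ⟩
        # (lookup C′) + # (N ∖ lookup C′)          ≡⟨ +-comm (# (lookup C′)) _ ⟩
        # (N ∖ lookup C′) + # (lookup C′)          ≡⟨ cong (# (N ∖ lookup C′) +_) (∣∣≡# C′) ⟨
        # (N ∖ lookup C′) + ∣ C′ ∣                 ≤⟨ +-monoʳ-≤ _ (m⊔n≤o⇒m≤o ∣ C′ ∣ _ cops) ⟩
        # (N ∖ lookup C′) + k                      ∎

  winning⇒sweepable : ∀ S → Winning G 1 S → copsUsed S ≤ k → Sweepable G k
  winning⇒sweepable (strategy C Cs) wins cops U τ τ≥1 τ≤ with τ ≤? # (U ∖ lookup C)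
  ... | yes τ≤′ = track τ≥1 C _ Cs (U ∖ lookup C) (λ v → ∧⁻ˡ) (λ v p → ∉ˢ⁺ (not⁻ (∧⁻ʳ {U v} p)))
          (λ v p → not⁻ (∧⁻ʳ {U v} p)) τ≤′ (m⊔n≤o⇒n≤o ∣ C ∣ _ cops) wins
  -- The first cops already push the territory below `τ`, so `U` itself is of suitable size, and its
  -- boundary in `U` is empty.
  ... | no τ≰ = U , (λ _ p → p) , τ≤ , (begin
          # U                                    ≡⟨ #-split U (lookup C) ⟩
          # (U ∩ lookup C) + # (U ∖ lookup C)    ≤⟨ +-mono-≤ (#-mono (λ v → ∧⁻ʳ {U v})) (<⇒≤ (≰⇒> τ≰)) ⟩
          # (lookup C) + τ                       ≡⟨ cong (_+ τ) (∣∣≡# C) ⟨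
          ∣ C ∣ + τ                              ≤⟨ +-monoˡ-≤ τ (m⊔n≤o⇒m≤o ∣ C ∣ _ cops) ⟩
          k + τ                                  ≡⟨ +-comm k τ ⟩
          τ + k                                  ∎) ,
          ≤-trans (≤-reflexive (#-empty λ v → ¬-not λ p → true≢false (∂⊆ G v p) (∂-out G p))) z≤n
    where open ≤-Reasoning

-- Tree decompositions from separators

module _ {m} {T : Graph m} where

  private
    suffix : ∀ {X u v w ℓ} (p : Walk T X v w ℓ) → Unique (vertices p) → u ∈ˡ vertices p →
             ∃[ ℓ′ ] Path T X u w ℓ′
    suffix p@(here _)     uniq       (here refl) = _ , p , uniq
    suffix p@(step _ _ _) uniq       (here refl) = _ , p , uniq
    suffix (step _ _ p)   (_ ∷ uniq) (there u∈)  = suffix p uniq u∈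

  data Route (K : BSet m) : Fin m → Fin m → Set where
    stop : ∀ {v} → v ∈ K → Route K v v
    hop  : ∀ {u v w} → u ∈ K → adj T u v ≡ true → Route K v w → Route K u w

  _⋯_ : ∀ {K u v w} → Route K u v → Route K v w → Route K u w
  stop _    ⋯ q = q
  hop a b p ⋯ q = hop a b (p ⋯ q)

  -- A vertex about to be repeated is handled by cutting the path back to its occurrence.
  route⇒path : ∀ {K X u w} → (∀ v → v ∈ K → v ∉ˢ X) → Route K u w → ∃[ ℓ ] Path T X u w ℓ
  route⇒path K∩X (stop v∈) = 0 , here (K∩X _ v∈) , [] ∷ []
  route⇒path {u = u} K∩X (hop u∈ uv r) with route⇒path K∩X r
  ... | ℓ , p , uniq with DecMembership._∈?_ Fin._≟_ u (vertices p)
  ...   | yes u∈p = suffix p uniq u∈p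
  ...   | no  u∉p = suc ℓ , step (K∩X _ u∈) uv p , ¬Any⇒All¬ _ u∉p ∷ uniq

-- The leaf attached last is node zero.
data Growth (n : ℕ) : ℕ → Set where
  root : BSet n → Growth n 1
  leaf : ∀ {m} → Growth n m → Fin m → BSet n → Growth n (suc m)

module _ {n : ℕ} where

  bags : ∀ {m} → Growth n m → Fin m → BSet n
  bags (root β)     _       = β
  bags (leaf d p β) zero    = β
  bags (leaf d p β) (suc t) = bags d t

  union : ∀ {m} → Growth n m → BSet n
  union (root β)     = β
  union (leaf d p β) = β ∪ union d

  bag⊆union : ∀ {m} (d : Growth n m) t → bags d t ⊆ union d
  bag⊆union (root β)     _       v q = q
  bag⊆union (leaf d p β) zero    v q = ∨⁺ˡ q
  bag⊆union (leaf d p β) (suc t) v q = ∨⁺ʳ {β v} (bag⊆union d t v q)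

  joined : ∀ {m} → Growth n m → Fin m → Fin m → Bool
  joined (root β)     _       _       = false
  joined (leaf d p β) zero    zero    = false
  joined (leaf d p β) zero    (suc j) = p == j
  joined (leaf d p β) (suc i) zero    = p == i
  joined (leaf d p β) (suc i) (suc j) = joined d i j

  skeleton : ∀ {m} → Growth n m → Graph m
  skeleton d = record { adj = joined d ; sym = symmetric d ; irrefl = irreflexive d }
    where
    symmetric : ∀ {m} (d : Growth n m) i j → joined d i j ≡ joined d j i
    symmetric (root β)     i       j       = refl
    symmetric (leaf d p β) zero    zero    = refl
    symmetric (leaf d p β) zero    (suc j) = refl
    symmetric (leaf d p β) (suc i) zero    = refl
    symmetric (leaf d p β) (suc i) (suc j) = symmetric d i j
    irreflexive : ∀ {m} (d : Growth n m) i → joined d i i ≡ false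
    irreflexive (root β)     i       = refl
    irreflexive (leaf d p β) zero    = refl
    irreflexive (leaf d p β) (suc i) = irreflexive d i

  nodes : ∀ {m} → Growth n m → 1 ≤ m
  nodes (root β)     = s≤s z≤n
  nodes (leaf d p β) = s≤s z≤n

  -- Connectedness of `K` checked at each attachment: a new leaf in `K` joins an already nonempty
  -- part of `K` only through a parent in `K`.
  Convex : ∀ {m} → Growth n m → BSet m → Set
  Convex (root β)     K = ⊤
  Convex (leaf d p β) K = (zero ∈ K → ∀ t → suc t ∈ K → suc p ∈ K) × Convex d (λ t → K (suc t))

  routes : ∀ {m} (d : Growth n m) {K} → Convex d K → ∀ s t → s ∈ K → t ∈ K → Route {T = skeleton d} K s t
  routes (root β)     _ zero    zero    s∈ t∈ = stop s∈
  routes (leaf d p β) _ zero    zero    s∈ t∈ = stop s∈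
  routes (leaf d p β) {K} (attach , convex) s t s∈ t∈ = go s t s∈ t∈
    where
    lift : ∀ {s t} → Route {T = skeleton d} (λ t → K (suc t)) s t → Route {T = skeleton (leaf d p β)} K (suc s) (suc t)
    lift (stop v∈)     = stop v∈
    lift (hop u∈ uv r) = hop u∈ uv (lift r)
    go : ∀ s t → s ∈ K → t ∈ K → Route {T = skeleton (leaf d p β)} K s t
    go zero    zero    s∈ t∈ = stop s∈
    go zero    (suc t) s∈ t∈ = let p∈ = attach s∈ t t∈ in hop s∈ (==⁺ refl) (lift (routes d convex p t p∈ t∈))
    go (suc s) zero    s∈ t∈ = let p∈ = attach t∈ s s∈ in
      lift (routes d convex s p s∈ p∈) ⋯ hop p∈ (==⁺ refl) (stop t∈)
    go (suc s) (suc t) s∈ t∈ = lift (routes d convex s t s∈ t∈)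

  private
    end∈ : ∀ {m} {T : Graph m} {X u w ℓ} (p : Walk T X u w ℓ) → w ∈ˡ vertices p
    end∈ (here _)     = here refl
    end∈ (step _ _ p) = there (end∈ p)

    start∈ : ∀ {m} {T : Graph m} {X u w ℓ} (p : Walk T X u w ℓ) → u ∈ˡ vertices p
    start∈ (here _)     = here refl
    start∈ (step _ _ p) = here refl

    repeats : ∀ {m} {u : Fin m} {vs} → Unique (u ∷ˡ vs) → ¬ u ∈ˡ vs
    repeats (u∉ ∷ _) u∈ = All.lookup u∉ u∈ refl

    module _ {m} {d : Growth n m} {p : Fin m} {β : BSet n} where

      private
        T = skeleton (leaf d p β)

      -- A path between older nodes cannot visit the leaf, because it would enter and leave through
      -- the same parent.
      unleaf : ∀ {u v ℓ} (q : Walk T ∅ (suc u) (suc v) ℓ) → Unique (vertices q) →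
               Σ (Walk (skeleton d) ∅ u v ℓ) λ q′ → vertices q ≡ map suc (vertices q′)
      unleaf (here _) uniq = here ∉⊥ , refl
      unleaf (step {v = suc x} _ e q) (_ ∷ uniq) with unleaf q uniq
      ... | q′ , eq = step ∉⊥ e q′ , cong (_ ∷ˡ_) eq
      unleaf (step {v = zero} _ e (step {v = suc y} _ e′ q)) uniq with ==⁻ {u = p} e | ==⁻ {u = p} e′
      ... | refl | refl = contradiction (there (start∈ q)) (repeats uniq)

      parent∈ : ∀ {a ℓ} (q : Walk T ∅ (suc a) zero ℓ) → suc p ∈ˡ vertices q
      parent∈ (step {v = suc x} _ e q) = there (parent∈ q)
      parent∈ (step {v = zero}  _ e q) with ==⁻ {u = p} e
      ... | refl = here refl

  skeleton-acyclic : ∀ {m} (d : Growth n m) → Acyclic (skeleton d)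
  skeleton-acyclic (root β)     u v ℓ _ _ ()
  skeleton-acyclic (leaf d p β) zero zero ℓ _ _ ()
  skeleton-acyclic (leaf d p β) zero (suc v) ℓ (step {v = suc x} _ e q , _ ∷ uniq) 2≤ vu
    with ==⁻ {u = p} e | ==⁻ {u = p} vu
  skeleton-acyclic (leaf d p β) zero (suc v) (suc zero) (step _ e q , _ ∷ uniq) (s≤s ()) vu | _ | _
  skeleton-acyclic (leaf d p β) zero (suc v) ℓ (step {v = suc x} _ e (step _ _ q) , _ ∷ uniq) 2≤ vu | refl | refl =
    repeats uniq (end∈ q)
  skeleton-acyclic (leaf d p β) (suc u) zero ℓ (step _ e (here _) , _) (s≤s ()) vu
  skeleton-acyclic (leaf d p β) (suc u) zero ℓ (step {v = zero} _ e (step _ _ q) , _ ∷ uniq) 2≤ vu =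
    repeats uniq (end∈ q)
  skeleton-acyclic (leaf d p β) (suc u) zero ℓ (step {v = suc x} _ e q , uniq) 2≤ vu with ==⁻ {u = p} vu
  ... | refl = repeats uniq (parent∈ q)
  skeleton-acyclic (leaf d p β) (suc u) (suc v) ℓ (q , uniq) 2≤ vu with unleaf q uniq
  ... | q′ , eq = skeleton-acyclic d u v ℓ
    (q′ , AllPairs.map (λ neq → neq ∘ cong suc) (AllPairs.map⁻ (subst Unique eq uniq))) 2≤ vu

  Valid : ∀ {m} → Growth n m → Set
  Valid (root β)     = ⊤
  Valid (leaf d p β) = (β ∩ union d ⊆ bags d p) × Valid d

  bag-convex : ∀ {m} (d : Growth n m) → Valid d → ∀ v → Convex d (λ t → bags d t v)
  bag-convex (root β)     _            v = tt
  bag-convex (leaf d p β) (ok , valid) v =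
    (λ v∈β t v∈ → ok v (∧⁺ v∈β (bag⊆union d t v v∈))) , bag-convex d valid v

  full-convex : ∀ {m} (d : Growth n m) → Convex d full
  full-convex (root β)     = tt
  full-convex (leaf d p β) = (λ _ _ _ → refl) , full-convex d

-- Decomposing along separators of sets of size `w`

module _ {n} (G : Graph n) {w θ : ℕ}
         (separate : ∀ W → # W ≡ w → ¬ WellLinked G θ W) where

  private
    separator : ∀ W → # W ≡ w →
                ¬ ¬ (∃[ A ] ∃[ C ] Closes G A C × # C ≤ θ × # C < # (W ∩ (A ∪ C)) × # C < # (W ∖ A))
    separator W #W k = separate W #W λ A C closes C≤ → decide A C closes C≤
      where
      decide : ∀ A C → Closes G A C → # C ≤ θ → # (W ∩ (A ∪ C)) ≤ # C ⊎ # (W ∖ A) ≤ # C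
      decide A C closes C≤ with # (W ∩ (A ∪ C)) ≤? # C | # (W ∖ A) ≤? # C
      ... | yes p | _     = inj₁ p
      ... | no  _ | yes q = inj₂ q
      ... | no  p | no  q = ⊥-elim (k (A , C , closes , C≤ , ≰⇒> p , ≰⇒> q))

    -- `within` is what the next piece needs: it limits the vertices already used, so that overlaps
    -- occur only at the interface.
    record Extension {m} (d : Growth n m) (V : BSet n) : Set where
      field
        {m′}     : ℕ
        d′       : Growth n m′
        valid    : Valid d′
        bounded  : ∀ t → # (bags d′ t) ≤ w + θ
        embed    : Fin m → Fin m′
        keeps    : ∀ t → bags d t ⊆ bags d′ (embed t)
        within   : ∀ v → v ∈ union d′ → v ∈ union d ⊎ v ∈ V
        vertex   : ∀ v → v ∈ V → ∃[ t ] v ∈ bags d′ t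
        edge     : ∀ u v → u ∈ V → v ∈ V → adj G u v ≡ true → ∃[ t ] u ∈ bags d′ t × v ∈ bags d′ t

    -- The interface `B` contains every old vertex of `V` and lies in the bag at `p`. It is filled
    -- up to a set `W` of size `w`, whose separator cuts `V` into two smaller pieces, both hung on
    -- the bag `W ∪ (C ∩ V)`.
    extend : ∀ s {m} (d : Growth n m) → Valid d → (∀ t → # (bags d t) ≤ w + θ) →
             ∀ p V B → # V ≤ s → B ⊆ V → # B ≤ w → B ⊆ bags d p → (∀ v → v ∈ V → v ∈ union d → v ∈ B) →
             ¬ ¬ Extension d V
    extend s d valid bounded p V B V≤ B⊆V B≤ B⊆p fresh k with # V ≤? w + θ
    ... | yes small = k record
      { d′      = leaf d p V
      ; valid   = (λ v q → B⊆p v (fresh v (∧⁻ˡ q) (∧⁻ʳ {V v} q))) , valid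
      ; bounded = λ { zero → small ; (suc t) → bounded t }
      ; embed   = suc
      ; keeps   = λ _ _ q → q
      ; within  = λ v q → [ inj₂ , inj₁ ]′ (∨⁻ q)
      ; vertex  = λ v q → zero , q
      ; edge    = λ u v p q _ → zero , p , q
      }
    extend zero    d valid bounded p V B V≤ B⊆V B≤ B⊆p fresh k | no big =
      contradiction (≤-trans V≤ z≤n) big
    extend (suc s) d valid bounded p V B V≤ B⊆V B≤ B⊆p fresh k | no big
      with #-between B V w B⊆V B≤ (≤-trans (m≤m+n w θ) (<⇒≤ (≰⇒> big)))
    ... | W , B⊆W , W⊆V , #W = separator W #W λ (A , C , closes , C≤ , inner , outer) → splitting A C closes C≤ inner outer
      where
      open ≤-Reasoning
      splitting : ∀ A C → Closes G A C → # C ≤ θ → # C < # (W ∩ (A ∪ C)) → # C < # (W ∖ A) → ⊥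
      splitting A C closes C≤ inner outer =
        extend s d₀ valid₀ bounded₀ zero V₁ B₁ V₁≤ B₁⊆V₁ B₁≤ B₁⊆β fresh₁ second
        where
        β V₁ B₁ V₂ B₂ : BSet n
        -- `C` may meet `A`, so the second piece and its interface receive only the part of `C`
        -- outside `A`.
        β  = W ∪ (C ∩ V)
        V₁ = V ∩ (A ∪ C)
        B₁ = (W ∩ A) ∪ (C ∩ V)
        V₂ = V ∖ A
        B₂ = (W ∖ (A ∪ C)) ∪ ((C ∩ V) ∖ A)
        d₀ = leaf d p β
        ∨-falseˡ : ∀ {a b} → a ∨ b ≡ false → a ≡ false
        ∨-falseˡ {false} _ = refl
        β⊆V : β ⊆ V
        β⊆V v q = [ W⊆V v , ∧⁻ʳ {C v} ]′ (∨⁻ q)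
        valid₀ : Valid d₀
        valid₀ = (λ v q → B⊆p v (fresh v (β⊆V v (∧⁻ˡ q)) (∧⁻ʳ {β v} q))) , valid
        bounded₀ : ∀ t → # (bags d₀ t) ≤ w + θ
        bounded₀ zero    = ≤-trans (#-cover (λ v → ∨⁻)) (+-mono-≤ (≤-reflexive #W) (≤-trans (#-mono (λ v → ∧⁻ˡ)) C≤))
        bounded₀ (suc t) = bounded t
        smaller : ∀ {V′} → V′ ⊆ V → (∃[ v ] v ∈ V × v ∉ V′) → # V′ ≤ s
        smaller {V′} sub (v , v∈ , v∉) = s≤s⁻¹ (≤-trans (begin
          1 + # V′               ≤⟨ +-monoˡ-≤ (# V′) (#-member {A = V ∖ V′} v (∧⁺ v∈ (not⁺ v∉))) ⟩
          # (V ∖ V′) + # V′      ≡⟨ +-comm (# (V ∖ V′)) (# V′) ⟩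
          # V′ + # (V ∖ V′)      ≤⟨ #-pack sub (λ v → ∧⁻ˡ) (λ v q → ¬-not λ r → true≢false q (not⁻ (∧⁻ʳ {V v} r))) ⟩
          # V                    ∎) V≤)
        -- `outer` yields a vertex of `W` outside both `A` and `C`, which the first piece lacks.
        V₁≤ : # V₁ ≤ s
        V₁≤ with #-excess {A = W ∖ A} {C} outer
        ... | v , v∈ , v∉C = smaller (λ v → ∧⁻ˡ) (v , W⊆V v (∧⁻ˡ v∈) , outside)
          where
          outside : v ∉ V₁
          outside rewrite not⁻ (∧⁻ʳ {W v} v∈) | v∉C with V v
          ... | true  = refl
          ... | false = refl
        V₂≤ : # V₂ ≤ s
        V₂≤ with #-excess {A = W ∩ (A ∪ C)} {C} inner
        ... | v , v∈ , v∉C with ∨⁻ {A v} (∧⁻ʳ {W v} v∈)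
        ...   | inj₂ c = true≢false c v∉C
        ...   | inj₁ a = smaller (λ v → ∧⁻ˡ) (v , W⊆V v (∧⁻ˡ v∈) , ¬-not λ q → true≢false a (not⁻ (∧⁻ʳ {V v} q)))
        B₁⊆V₁ : B₁ ⊆ V₁
        B₁⊆V₁ v q with ∨⁻ {W v ∧ A v} q
        ... | inj₁ r = ∧⁺ (W⊆V v (∧⁻ˡ r)) (∨⁺ˡ (∧⁻ʳ {W v} r))
        ... | inj₂ r = ∧⁺ (∧⁻ʳ {C v} r) (∨⁺ʳ {A v} (∧⁻ˡ r))
        B₂⊆V₂ : B₂ ⊆ V₂
        B₂⊆V₂ v q with ∨⁻ {W v ∧ not (A v ∨ C v)} q
        ... | inj₁ r = ∧⁺ (W⊆V v (∧⁻ˡ r)) (not⁺ (∨-falseˡ (not⁻ (∧⁻ʳ {W v} r))))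
        ... | inj₂ r = ∧⁺ (∧⁻ʳ {C v} (∧⁻ˡ {C v ∧ V v} r)) (∧⁻ʳ {C v ∧ V v} r)
        -- `C` has fewer vertices than the part of `W` that it replaces.
        B₁≤ : # B₁ ≤ w
        B₁≤ = begin
          # B₁                           ≤⟨ #-cover (λ v → ∨⁻) ⟩
          # (W ∩ A) + # (C ∩ V)          ≤⟨ +-monoʳ-≤ _ (≤-trans (#-mono (λ v → ∧⁻ˡ)) (<⇒≤ outer)) ⟩
          # (W ∩ A) + # (W ∖ A)          ≡⟨ #-split W A ⟨
          # W                            ≡⟨ #W ⟩
          w                              ∎
        B₂≤ : # B₂ ≤ w
        B₂≤ = begin
          # B₂                                     ≤⟨ #-cover (λ v → ∨⁻) ⟩
          # (W ∖ (A ∪ C)) + # ((C ∩ V) ∖ A)        ≤⟨ +-monoʳ-≤ _ (≤-trans (#-mono (λ v → ∧⁻ˡ ∘ ∧⁻ˡ {C v ∧ V v})) (<⇒≤ inner)) ⟩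
          # (W ∖ (A ∪ C)) + # (W ∩ (A ∪ C))        ≡⟨ +-comm (# (W ∖ (A ∪ C))) _ ⟩
          # (W ∩ (A ∪ C)) + # (W ∖ (A ∪ C))        ≡⟨ #-split W (A ∪ C) ⟨
          # W                                      ≡⟨ #W ⟩
          w                                        ∎
        B₁⊆β : B₁ ⊆ β
        B₁⊆β v q = [ (λ r → ∨⁺ˡ {W v} (∧⁻ˡ {W v} r)) , ∨⁺ʳ {W v} ]′ (∨⁻ {W v ∧ A v} q)
        B₂⊆β : B₂ ⊆ β
        B₂⊆β v q = [ (λ r → ∨⁺ˡ {W v} (∧⁻ˡ {W v} r)) , (λ r → ∨⁺ʳ {W v} (∧⁻ˡ r)) ]′ (∨⁻ {W v ∧ not (A v ∨ C v)} q)
        β-or-old : ∀ v → v ∈ V → v ∈ union d₀ → v ∈ β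
        β-or-old v v∈ q = [ id , (λ r → ∨⁺ˡ (B⊆W v (fresh v v∈ r))) ]′ (∨⁻ q)
        fresh₁ : ∀ v → v ∈ V₁ → v ∈ union d₀ → v ∈ B₁
        fresh₁ v v∈ q with ∨⁻ {W v} (β-or-old v (∧⁻ˡ v∈) q) | ∨⁻ {A v} (∧⁻ʳ {V v} v∈)
        ... | inj₂ r | _      = ∨⁺ʳ {W v ∧ A v} r
        ... | inj₁ r | inj₁ a = ∨⁺ˡ (∧⁺ r a)
        ... | inj₁ r | inj₂ c = ∨⁺ʳ {W v ∧ A v} (∧⁺ c (∧⁻ˡ v∈))
        fresh₂ : ∀ v → v ∈ V₂ → v ∈ union d₀ → v ∈ B₂
        fresh₂ v v∈ q with split (C v) | ∨⁻ {W v} (β-or-old v (∧⁻ˡ v∈) q)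
        ... | inj₁ c | _      = ∨⁺ʳ {W v ∧ not (A v ∨ C v)} (∧⁺ (∧⁺ c (∧⁻ˡ v∈)) (∧⁻ʳ {V v} v∈))
        ... | inj₂ c | inj₂ r = true≢false (∧⁻ˡ {C v} r) c
        ... | inj₂ c | inj₁ r = ∨⁺ˡ (∧⁺ r (not⁺ outside))
          where
          outside : A v ∨ C v ≡ false
          outside rewrite not⁻ (∧⁻ʳ {V v} v∈) = c
        shared : ∀ v → v ∈ V₂ → v ∈ V₁ → v ∈ B₂
        shared v v∈₂ v∈₁ with ∨⁻ {A v} (∧⁻ʳ {V v} v∈₁)
        ... | inj₁ a = true≢false a (not⁻ (∧⁻ʳ {V v} v∈₂))
        ... | inj₂ c = ∨⁺ʳ {W v ∧ not (A v ∨ C v)} (∧⁺ (∧⁺ c (∧⁻ˡ v∈₁)) (∧⁻ʳ {V v} v∈₂))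
        cover-edge : ∀ u v → u ∈ V → v ∈ V → adj G u v ≡ true → {P : Set} →
                     (u ∈ V₁ → v ∈ V₁ → P) → (u ∈ V₂ → v ∈ V₂ → P) → P
        cover-edge u v p q uv first second with split (A u) | split (A v)
        ... | inj₁ a | inj₁ b = first (∧⁺ p (∨⁺ˡ a)) (∧⁺ q (∨⁺ˡ b))
        ... | inj₁ a | inj₂ b = first (∧⁺ p (∨⁺ˡ a)) (∧⁺ q (∨⁺ʳ {A v} (closes u v a uv b)))
        ... | inj₂ a | inj₁ b = first (∧⁺ p (∨⁺ʳ {A u} (closes v u b (trans (sym G v u) uv) a))) (∧⁺ q (∨⁺ˡ b))
        ... | inj₂ a | inj₂ b = second (∧⁺ p (not⁺ a)) (∧⁺ q (not⁺ b))

        module _ (E₁ : Extension d₀ V₁) where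
          open Extension E₁ renaming (d′ to d₁; valid to valid₁; bounded to bounded₁; embed to embed₁;
                                      keeps to keeps₁; within to within₁; vertex to vertex₁; edge to edge₁)
          module _ (E₂ : Extension d₁ V₂) where
            open Extension E₂ renaming (d′ to d₂; valid to valid₂; bounded to bounded₂; embed to embed₂;
                                        keeps to keeps₂; within to within₂; vertex to vertex₂; edge to edge₂)
            combined : Extension d V
            combined = record
              { d′      = d₂
              ; valid   = valid₂
              ; bounded = bounded₂
              ; embed   = λ t → embed₂ (embed₁ (suc t))
              ; keeps   = λ t v q → keeps₂ _ v (keeps₁ (suc t) v q)
              ; within  = λ v q → [ (λ r → [ (λ r → [ (λ r → inj₂ (β⊆V v r)) , inj₁ ]′ (∨⁻ {β v} r))
                                          , (λ r → inj₂ (∧⁻ˡ r)) ]′ (within₁ v r))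
                                  , (λ r → inj₂ (∧⁻ˡ r)) ]′ (within₂ v q)
              ; vertex  = λ v q → [ (λ r → let t , x = vertex₁ v (∧⁺ q r) in embed₂ t , keeps₂ t v x)
                                  , (λ r → vertex₂ v (∧⁺ q (not⁺ (∨-falseˡ r)))) ]′ (split ((A ∪ C) v))
              ; edge    = λ u v p q uv → cover-edge u v p q uv
                  (λ p q → let t , x , y = edge₁ u v p q uv in embed₂ t , keeps₂ t u x , keeps₂ t v y)
                  (λ p q → edge₂ u v p q uv)
              }
          second : ⊥
          second = extend s d₁ valid₁ bounded₁ (embed₁ zero) V₂ B₂ V₂≤ B₂⊆V₂ B₂≤
            (λ v → keeps₁ zero v ∘ B₂⊆β v)
            (λ v v∈ v∈d₁ → [ fresh₂ v v∈ , shared v v∈ ]′ (within₁ v v∈d₁)) (λ E₂ → k (combined E₂))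

    decomposition : ∀ {m} (d : Growth n m) → Valid d → (∀ v → ∃[ t ] v ∈ bags d t) →
                    (∀ u v → adj G u v ≡ true → ∃[ t ] u ∈ bags d t × v ∈ bags d t) → TreeDecomposition G
    decomposition {m} d valid vertex edge = record
      { tree = record
        { size      = m
        ; nonempty  = nodes d
        ; graph     = skeleton d
        ; connected = λ s t → route⇒path {K = full} (λ _ _ → ∉⊥) (routes d (full-convex d) s t refl refl)
        ; acyclic   = skeleton-acyclic d
        }
      ; bag = λ t → tabulate (bags d t)
      ; covers-vertices = λ v → let t , q = vertex v in t , ∈tab q
      ; covers-edges = λ u v uv → let t , p , q = edge u v uv in t , ∈tab p , ∈tab q
      ; subtree = λ v s t p q → route⇒path {K = λ x → bags d x v} (λ x r → x∈p⇒x∉∁p (∈tab (trans (lookup∘tabulate _ v) r)))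
          (routes d (bag-convex d valid v) s t (tab∈ p) (tab∈ q))
      }
      where
      ∈tab : ∀ {k} {K : BSet k} {x} → x ∈ K → x ∈ˢ tabulate K
      ∈tab {K = K} {x} p = lookup⇒[]= x _ (trans (lookup∘tabulate K x) p)
      tab∈ : ∀ {k} {K : BSet k} {x} → x ∈ˢ tabulate K → x ∈ K
      tab∈ {K = K} {x} p = trans (≡-sym (lookup∘tabulate K x)) ([]=⇒lookup p)

    maximum-≤ : ∀ {A : Set} (f : A → ℕ) {b} → (∀ x → f x ≤ b) → ∀ xs → maximum (map f xs) ≤ b
    maximum-≤ f p []ˡ       = z≤n
    maximum-≤ f p (x ∷ˡ xs) = ⊔-lub (p x) (maximum-≤ f p xs)

  treewidth-bound : ¬ TreewidthAtLeast G (suc (w + θ))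
  -- The growth starts from an empty root bag, so that all vertices are still to be placed and the
  -- interface is empty.
  treewidth-bound wide = extend n (root none) tt (λ t → ≤-trans (≤-reflexive (#-none n)) z≤n) zero full none
    (≤-reflexive (#-full n)) (λ _ ()) (≤-trans (≤-reflexive (#-none n)) z≤n) (λ _ ()) (λ _ _ q → q) narrow
    where
    narrow : ¬ Extension (root none) full
    narrow E = <-irrefl refl (≤-trans (wide (decomposition d′ valid (λ v → vertex v refl) (λ u v → edge u v refl refl)))
      (≤-trans (m∸n≤m _ 1) (maximum-≤ _ (λ t → ≤-trans (≤-reflexive
        (trans (∣∣≡# (tabulate (bags d′ t))) (#-cong (lookup∘tabulate (bags d′ t))))) (bounded t)) (allFin _))))
      where open Extension E

-- Choice of the parameters

n<2^n : ∀ n → n < 2 ^ n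
n<2^n zero    = s≤s z≤n
n<2^n (suc n) = begin-strict
  suc n              <⟨ s≤s (n<2^n n) ⟩
  suc (2 ^ n)        ≤⟨ +-monoˡ-≤ (2 ^ n) (m^n>0 2 n) ⟩
  2 ^ n + 2 ^ n      ≡⟨ cong (2 ^ n +_) (+-identityʳ (2 ^ n)) ⟨
  2 ^ suc n          ∎
  where open ≤-Reasoning

-- With `x = suc p`, `D` is at most `4 * a * x`, so the left side is at most `112 * a * a * x * x`.
-- Taking `p = 11 * a` puts `112 * a * a` below `x * x`, and the fourth power of `x` is at most
-- `2 ^ (4 * p)`.
square<2^ : ∀ {a p D t} → 1 ≤ D → t ≤ D → D ≤ a * (4 * p + 1) → p ≡ 11 * a →
            3 * (2 * (D * D)) + t < 2 ^ (p + p + (p + p))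
square<2^ {a} {p} {D} {t} D≥1 t≤D D≤ refl = begin-strict
  3 * (2 * (D * D)) + t               ≤⟨ +-monoʳ-≤ (3 * (2 * (D * D))) (≤-trans t≤D (≤-trans (≤-reflexive (≡-sym (*-identityʳ D))) (*-monoʳ-≤ D D≥1))) ⟩
  3 * (2 * (D * D)) + D * D           ≡⟨ seven (D * D) ⟩
  7 * (D * D)                         ≤⟨ *-monoʳ-≤ 7 (*-mono-≤ D≤x D≤x) ⟩
  7 * (4 * a * x * (4 * a * x))       ≡⟨ regroup a x ⟩
  7 * (4 * a * (4 * a)) * (x * x)     <⟨ *-monoˡ-< (x * x) (≤-trans (m≤m+n (suc (7 * (4 * a * (4 * a)))) (9 * a * a + 22 * a)) (≤-reflexive (eleven a))) ⟩
  x * x * (x * x)                     ≤⟨ *-mono-≤ xx≤ xx≤ ⟩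
  2 ^ (p + p) * 2 ^ (p + p)           ≡⟨ ^-distribˡ-+-* 2 (p + p) (p + p) ⟨
  2 ^ (p + p + (p + p))               ∎
  where
  open ≤-Reasoning
  x = suc p
  seven : ∀ y → 3 * (2 * y) + y ≡ 7 * y
  seven = solve-∀
  regroup : ∀ a x → 7 * (4 * a * x * (4 * a * x)) ≡ 7 * (4 * a * (4 * a)) * (x * x)
  regroup = solve-∀
  eleven : ∀ a → suc (7 * (4 * a * (4 * a))) + (9 * a * a + 22 * a) ≡ suc (11 * a) * suc (11 * a)
  eleven = solve-∀
  D≤x : D ≤ 4 * a * x
  D≤x = ≤-trans D≤ (≤-trans (m≤m+n _ (3 * a)) (≤-reflexive (rearrange a p)))
    where
    rearrange : ∀ a p → a * (4 * p + 1) + 3 * a ≡ 4 * a * suc p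
    rearrange = solve-∀
  xx≤ : x * x ≤ 2 ^ (p + p)
  xx≤ = ≤-trans (*-mono-≤ (n<2^n p) (n<2^n p)) (≤-reflexive (≡-sym (^-distribˡ-+-* 2 p p)))

module _ (k : ℕ) where
  private
    -- `r` comes from `few-long-walks` and `b` from the loss in `smaller`; `j = 2 * h + b` makes
    -- `2 ^ j` exceed `2 ^ h * 2 ^ h * b`. As `h = 4 * p`, `D` is at most `a * (4 * p + 1)`, and
    -- `square<2^` asks for `p = 11 * a`.
    r = 8 + 14 * k
    b = 8 + 4 * r
    a = 2 * r + b * k
    p = 11 * a
    h = p + p + (p + p)
    j = h + h + b
    D = r + (j * k + r)
    e = 2 * (D * D)

  opaque
    tangle-width : ℕ
    tangle-width = 2 ^ h

    no-well-linked-set : ∀ {n} (G : Graph n) → Sweepable G k → ∀ W → # W ≡ tangle-width → ¬ WellLinked G tangle-width W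
    no-well-linked-set G sweep W #W linked =
      descent G k sweep W e {r = r} {h = h} {j = j} linked refl #W (≤-reflexive #W) room ≤-refl r≤e r≤θ j-big (# full) full ≤-refl
        (full-tangle G k sweep W e linked r≤θ r≤e
          (≤-trans (s≤s (+-monoʳ-≤ (3 * e) (m≤n+m r (j * k)))) room))
      where
      D≥r : r ≤ D
      D≥r = m≤m+n r (j * k + r)
      D≥1 : 1 ≤ D
      D≥1 = ≤-trans (s≤s z≤n) D≥r
      r≤e : r ≤ e
      r≤e = ≤-trans D≥r (≤-trans (≤-reflexive (≡-sym (*-identityʳ D)))
              (≤-trans (*-monoʳ-≤ D D≥1) (m≤m+n (D * D) _)))
      D≤ : D ≤ a * (4 * p + 1)
      D≤ = ≤-trans (m≤m+n D (2 * r * h + (6 + 4 * r) * k * h)) (≤-reflexive (lemma r k p))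
        where
        lemma : ∀ r k p → r + ((p + p + (p + p) + (p + p + (p + p)) + (8 + 4 * r)) * k + r)
                            + (2 * r * (p + p + (p + p)) + (6 + 4 * r) * k * (p + p + (p + p)))
                        ≡ (2 * r + (8 + 4 * r) * k) * (4 * p + 1)
        lemma = solve-∀
      room′ : 3 * e + (j * k + r) < 2 ^ h
      room′ = square<2^ {a} D≥1 (m≤n+m (j * k + r) r) D≤ refl
      room : 3 * e + (j * k + r) < # W
      room = ≤-trans room′ (≤-reflexive (≡-sym #W))
      r≤θ : r ≤ 2 ^ h
      r≤θ = ≤-trans r≤e (≤-trans (m≤m+n e _) (≤-trans (m≤m+n (3 * e) _) (<⇒≤ room′)))
      j-big : # W * # W * b < 2 ^ j
      j-big = subst (λ w → w * w * b < 2 ^ j) (≡-sym #W) (≤-trans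
        (*-monoʳ-< (2 ^ h * 2 ^ h) {{m*n≢0 (2 ^ h) (2 ^ h) {{m^n≢0 2 h}} {{m^n≢0 2 h}}}} (n<2^n b))
        (≤-reflexive (≡-sym (trans (^-distribˡ-+-* 2 (h + h) b) (cong (_* 2 ^ b) (^-distribˡ-+-* 2 h h))))))

theorem4p16 : ∀ (k : ℕ) → ∃[ g ] (∀ (n : ℕ) (G : Graph n) →
    TreewidthAtLeast G g → BcwGreaterThan 1 G k)
theorem4p16 k = suc (tangle-width k + tangle-width k) , λ n G wide S wins cops →
  treewidth-bound G {tangle-width k} {tangle-width k} (no-well-linked-set k G (winning⇒sweepable G S wins cops)) wide
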